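{- Let $\mathcal{H}$ be a hypersequent in which each member of each sequent is a prenex $\mathrm{RPL}\forall$-formula or a semipropositional variable. Then any $\mathrm{G}^3\text{\L}\forall$-proof $D$ for $\mathcal{H}$ can be transformed into a mid-hypersequent $\mathrm{G}^3\text{\L}\forall$-proof $\widehat{D}$ for $\mathcal{H}$; moreover, $Q(\widehat{D})\leqslant Q(D)$, where $Q(\mathcal{D})$ is the number of quantifier rule applications in a $\mathrm{G}^3\text{\L}\forall$-proof $\mathcal{D}$.
   Context: Syntax. Fix a signature of predicate and function symbols of arbitrary nonnegative arities that includes a countable set of nullary function symbols called parameters (there are infinitely many of them). Terms are standard. Atomic $\mathrm{RPL}\forall$-formulas are $P(t_1,\dots,t_n)$ ($P$ a predicate symbol, $t_i$ terms) and truth constants $\bar r$ for rational $r\in[0,1]$. $\mathrm{RPL}\forall$-formulas are built from these using the logical symbols $\to$ (binary), $\forall$, $\exists$. A prenex formula consists of a (possibly empty) string of quantifiers followed by a quantifier-free formula. $[A]^x_t$ is the result of substituting $t$ for all free occurrences of the variable $x$ in $A$. In addition there are countably (infinitely) many semipropositional variables of type 1, and countably (infinitely) many semipropositional variables of type 0. A formula is an $\mathrm{RPL}\forall$-formula or a semipropositional variable (so semipropositional variables do not occur inside compound formulas). An atom is an atomic $\mathrm{RPL}\forall$-formula or a semipropositional variable. A sequent $\Gamma\Rightarrow\Delta$ is an ordered pair of finite multisets of formulas (its members); it is atomic if all its members are atoms. A hypersequent $S_1\,|\,\cdots\,|\,S_n$ is a finite multiset of sequents. Semantics (needed for axioms).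 An hs-interpretation $M=\langle\mathcal{D},\mu\rangle$ has a nonempty domain $\mathcal{D}$; $\mu$ interprets $n$-ary function symbols by functions $\mathcal{D}^n\to\mathcal{D}$, $n$-ary predicate symbols by maps $\mathcal{D}^n\to[0,1]$, each semipropositional variable of type 0 by a real in $[0,+\infty)$, and each of type 1 by a real in $(-\infty,1]$. A valuation $\nu$ maps individual variables to $\mathcal{D}$. For atoms: $|\bar r|_{M,\nu}=r$; $|P(t_1,\dots,t_n)|_{M,\nu}=\mu(P)(|t_1|_{M,\nu},\dots,|t_n|_{M,\nu})$; a semipropositional variable has the value given by $\mu$. For a finite multiset $\Gamma$ of atoms, $|\Gamma|_{M,\nu}=\sum_{F\in\Gamma}(|F|_{M,\nu}-1)$ (with multiplicity; $0$ if $\Gamma$ is empty). An atomic sequent $\Gamma\Rightarrow\Delta$ is true under $M,\nu$ if $|\Delta|_{M,\nu}-|\Gamma|_{M,\nu}\geqslant0$. Calculus $\mathrm{G}^3\text{\L}\forall$. Axioms: all hypersequents in which, for every hs-interpretation $M$ and valuation $\nu$, there is an atomic sequent true under $M$ and $\nu$. Rules (premises / conclusion), with $A,B$ $\mathrm{RPL}\forall$-formulas, $\Gamma,\Delta$ finite multisets of formulas, $\mathcal{G}$ a (possibly empty) hypersequent: $(\to\Rightarrow)^3$: $\mathcal{G}\,|\,\Gamma,\mathfrak{p}\Rightarrow\Delta\,|\,B\Rightarrow\mathfrak{p},A$ / $\mathcal{G}\,|\,\Gamma,A\to B\Rightarrow\Delta$; $(\Rightarrow\to)^3$: $\mathcal{G}\,|\,\Gamma\Rightarrow\Delta$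 and $\mathcal{G}\,|\,\Gamma,A\Rightarrow B,\Delta$ / $\mathcal{G}\,|\,\Gamma\Rightarrow A\to B,\Delta$; $(\forall\Rightarrow)^3$: $\mathcal{G}\,|\,\Gamma,\mathfrak{p}\Rightarrow\Delta\,|\,\forall xA\Rightarrow\mathfrak{p}\,|\,[A]^x_t\Rightarrow\mathfrak{p}$ / $\mathcal{G}\,|\,\Gamma,\forall xA\Rightarrow\Delta$; $(\Rightarrow\forall)^3$: $\mathcal{G}\,|\,\Gamma\Rightarrow[A]^x_a,\Delta$ / $\mathcal{G}\,|\,\Gamma\Rightarrow\forall xA,\Delta$; $(\Rightarrow\exists)^3$: $\mathcal{G}\,|\,\Gamma\Rightarrow\mathfrak{q},\Delta\,|\,\mathfrak{q}\Rightarrow\exists xA\,|\,\mathfrak{q}\Rightarrow[A]^x_t$ / $\mathcal{G}\,|\,\Gamma\Rightarrow\exists xA,\Delta$; $(\exists\Rightarrow)^3$: $\mathcal{G}\,|\,\Gamma,[A]^x_a\Rightarrow\Delta$ / $\mathcal{G}\,|\,\Gamma,\exists xA\Rightarrow\Delta$. Here $\mathfrak{p}$ (type 1) and $\mathfrak{q}$ (type 0) are semipropositional variables not occurring in the conclusion, $t$ is a closed term, and $a$ is a parameter not occurring in the conclusion. Proofs are finite trees of hypersequents (root at the bottom) built by the rules with all leaves axioms. The propositional rules are $(\to\Rightarrow)^3$ and $(\Rightarrow\to)^3$; the other four are the quantifier rules. A $\mathrm{G}^3\text{\L}\forall$-proof is a mid-hypersequent proof if in it all applications of propositional rules are above all applications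 of quantifier rules (equivalently, no quantifier rule application stands above a propositional rule application). -}

module Defs where

open import Data.Bool.Base using (if_then_else_)
open import Data.List.Base using (List; []; _∷_)
open import Data.List.Relation.Binary.Permutation.Propositional
  using (_↭_; ↭-setoid)
import Data.List.Relation.Binary.Permutation.Setoid as PermutationSetoid
open import Data.List.Relation.Unary.All using (All; []; _∷_)
open import Data.List.Relation.Unary.Any using (Any)
open import Data.Nat.Base as ℕ using (ℕ; suc; _⊔_)
import Data.Nat.Properties as ℕₚ
open import Data.Product.Base using (Σ-syntax; ∃-syntax; _×_; _,_; proj₁; proj₂)
open import Data.Product.Relation.Binary.Pointwise.NonDependent using (×-setoid)
open import Data.Rational.Base as ℚ using (ℚ; 0ℚ; 1ℚ; ½; ∣_∣)
import Data.Rational.Properties as ℚₚ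
open import Data.Sum.Base using (_⊎_)
open import Data.Unit.Base using (⊤)
open import Data.Vec.Base using (Vec; []; _∷_)
import Data.Vec.Relation.Unary.All as Vec
import Data.Vec.Relation.Unary.Any as Vec
open import Level using (0ℓ)
open import Relation.Binary.Bundles using (Setoid)
open import Relation.Binary.PropositionalEquality
  using (_≡_; sym; trans; cong; subst; module ≡-Reasoning)
open import Relation.Nullary.Decidable.Core using (does)
open import Relation.Nullary.Negation.Core using (¬_)

-- The real numbers as Cauchy sequences of rationals; two sequences denote
-- the same real when each is ≤ᵣ the other.

record ℝ : Set where
  field
    seq    : ℕ → ℚ
    cauchy : ∀ ε → 0ℚ ℚ.< ε →
             ∃[ N ] (∀ m n → N ℕ.≤ m → N ℕ.≤ n → ∣ seq m ℚ.- seq n ∣ ℚ.< ε)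
open ℝ public

infix 4 _≤ᵣ_
_≤ᵣ_ : ℝ → ℝ → Set
x ≤ᵣ y = ∀ ε → 0ℚ ℚ.< ε → ∃[ N ] (∀ n → N ℕ.≤ n → seq x n ℚ.≤ seq y n ℚ.+ ε)

fromℚ : ℚ → ℝ
fromℚ q .seq    _       = q
fromℚ q .cauchy ε 0<ε = 0 , λ _ _ _ _ →
  subst (ℚ._< ε) (sym (cong ∣_∣ (ℚₚ.+-inverseʳ q))) 0<ε

private
  ½*-pos : ∀ ε → 0ℚ ℚ.< ε → 0ℚ ℚ.< ½ ℚ.* ε
  ½*-pos ε 0<ε = subst (ℚ._< ½ ℚ.* ε) (ℚₚ.*-zeroʳ ½) (ℚₚ.*-monoʳ-<-pos ½ 0<ε)

  ½*+½* : ∀ ε → ½ ℚ.* ε ℚ.+ ½ ℚ.* ε ≡ ε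
  ½*+½* ε = trans (sym (ℚₚ.*-distribʳ-+ ε ½ ½)) (ℚₚ.*-identityˡ ε)

  interchange : ∀ a b c d →
    (a ℚ.+ b) ℚ.- (c ℚ.+ d) ≡ (a ℚ.- c) ℚ.+ (b ℚ.- d)
  interchange a b c d = begin
    (a ℚ.+ b) ℚ.+ ℚ.- (c ℚ.+ d)          ≡⟨ cong ((a ℚ.+ b) ℚ.+_) (ℚₚ.neg-distrib-+ c d) ⟩
    (a ℚ.+ b) ℚ.+ (ℚ.- c ℚ.+ ℚ.- d)      ≡⟨ ℚₚ.+-assoc a b _ ⟩
    a ℚ.+ (b ℚ.+ (ℚ.- c ℚ.+ ℚ.- d))      ≡⟨ cong (a ℚ.+_) (sym (ℚₚ.+-assoc b _ _)) ⟩
    a ℚ.+ ((b ℚ.+ ℚ.- c) ℚ.+ ℚ.- d)      ≡⟨ cong (λ z → a ℚ.+ (z ℚ.+ ℚ.- d)) (ℚₚ.+-comm b _) ⟩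
    a ℚ.+ ((ℚ.- c ℚ.+ b) ℚ.+ ℚ.- d)      ≡⟨ cong (a ℚ.+_) (ℚₚ.+-assoc (ℚ.- c) b (ℚ.- d)) ⟩
    a ℚ.+ (ℚ.- c ℚ.+ (b ℚ.+ ℚ.- d))      ≡⟨ sym (ℚₚ.+-assoc a _ _) ⟩
    (a ℚ.+ ℚ.- c) ℚ.+ (b ℚ.+ ℚ.- d)      ∎
    where open ≡-Reasoning

infixl 6 _+ᵣ_ _-ᵣ_
infix  8 -ᵣ_

_+ᵣ_ : ℝ → ℝ → ℝ
(x +ᵣ y) .seq n = seq x n ℚ.+ seq y n
(x +ᵣ y) .cauchy ε 0<ε =
  let M , p = cauchy x (½ ℚ.* ε) (½*-pos ε 0<ε)
      N , q = cauchy y (½ ℚ.* ε) (½*-pos ε 0<ε)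
  in M ⊔ N , λ m n m≥ n≥ → ℚₚ.≤-<-trans
    (subst (λ z → ∣ z ∣ ℚ.≤ ∣ seq x m ℚ.- seq x n ∣ ℚ.+ ∣ seq y m ℚ.- seq y n ∣)
      (sym (interchange (seq x m) (seq y m) (seq x n) (seq y n)))
      (ℚₚ.∣p+q∣≤∣p∣+∣q∣ (seq x m ℚ.- seq x n) (seq y m ℚ.- seq y n)))
    (subst (∣ seq x m ℚ.- seq x n ∣ ℚ.+ ∣ seq y m ℚ.- seq y n ∣ ℚ.<_) (½*+½* ε)
      (ℚₚ.+-mono-<
        (p m n (ℕₚ.m⊔n≤o⇒m≤o M N m≥) (ℕₚ.m⊔n≤o⇒m≤o M N n≥))
        (q m n (ℕₚ.m⊔n≤o⇒n≤o M N m≥) (ℕₚ.m⊔n≤o⇒n≤o M N n≥))))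

-ᵣ_ : ℝ → ℝ
(-ᵣ x) .seq n = ℚ.- seq x n
(-ᵣ x) .cauchy ε 0<ε =
  let N , p = cauchy x ε 0<ε
  in N , λ m n m≥ n≥ → subst (ℚ._< ε)
    (trans (sym (ℚₚ.∣-p∣≡∣p∣ (seq x m ℚ.- seq x n)))
           (cong ∣_∣ (ℚₚ.neg-distrib-+ (seq x m) (ℚ.- seq x n))))
    (p m n m≥ n≥)

_-ᵣ_ : ℝ → ℝ → ℝ
x -ᵣ y = x +ᵣ (-ᵣ y)

0ᵣ 1ᵣ : ℝ
0ᵣ = fromℚ 0ℚ
1ᵣ = fromℚ 1ℚ

-- Irrelevant bounds, so that truth constants with equal values are equal.
record RationalUnit : Set where
  constructor mk
  field
    value : ℚ
    .0≤   : 0ℚ ℚ.≤ value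
    .≤1   : value ℚ.≤ 1ℚ
open RationalUnit public using (value)

UnitInterval NonNegative AtMostOne : Set
UnitInterval = Σ[ r ∈ ℝ ] (0ᵣ ≤ᵣ r × r ≤ᵣ 1ᵣ)
NonNegative  = Σ[ r ∈ ℝ ] 0ᵣ ≤ᵣ r
AtMostOne    = Σ[ r ∈ ℝ ] r ≤ᵣ 1ᵣ

Var Param : Set
Var   = ℕ
Param = ℕ

-- Fun n holds the n-ary function symbols other than the parameters, which
-- every signature additionally contains (see Term below).
record Signature : Set₁ where
  field
    Fun  : ℕ → Set
    Pred : ℕ → Set

module Calculus (Sig : Signature) where
  open Signature Sig

  data Term : Set where
    var : Var → Term
    par : Param → Term
    app : ∀ {n} → Fun n → Vec Term n → Term

  data Atomic : Set where
    pred  : ∀ {n} → Pred n → Vec Term n → Atomic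
    const : RationalUnit → Atomic

  infixr 6 _⊃_
  data RPL∀ : Set where
    atom : Atomic → RPL∀
    _⊃_  : RPL∀ → RPL∀ → RPL∀
    all  : Var → RPL∀ → RPL∀
    ex   : Var → RPL∀ → RPL∀

  data QuantifierFree : RPL∀ → Set where
    atom : ∀ P → QuantifierFree (atom P)
    _⊃_  : ∀ {A B} → QuantifierFree A → QuantifierFree B → QuantifierFree (A ⊃ B)

  data Prenex : RPL∀ → Set where
    qf  : ∀ {A} → QuantifierFree A → Prenex A
    all : ∀ {A} x → Prenex A → Prenex (all x A)
    ex  : ∀ {A} x → Prenex A → Prenex (ex x A)

  data Closed : Term → Set where
    par : ∀ a → Closed (par a)
    app : ∀ {n} (f : Fun n) {ts} → Vec.All Closed ts → Closed (app f ts)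

  -- A [ t / x ] replaces the free occurrences of x without renaming bound
  -- variables; the rules use it with closed t only, so nothing is captured.
  infix 9 _[_/_]ₜ _[_/_]ₜₛ _[_/_]ₐ _[_/_]
  mutual
    _[_/_]ₜ : Term → Term → Var → Term
    var y    [ t / x ]ₜ = if does (x ℕₚ.≟ y) then t else var y
    par a    [ t / x ]ₜ = par a
    app f ts [ t / x ]ₜ = app f (ts [ t / x ]ₜₛ)

    _[_/_]ₜₛ : ∀ {n} → Vec Term n → Term → Var → Vec Term n
    []       [ t / x ]ₜₛ = []
    (s ∷ ts) [ t / x ]ₜₛ = s [ t / x ]ₜ ∷ ts [ t / x ]ₜₛ

  _[_/_]ₐ : Atomic → Term → Var → Atomic
  pred P ts [ t / x ]ₐ = pred P (ts [ t / x ]ₜₛ)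
  const r   [ t / x ]ₐ = const r

  _[_/_] : RPL∀ → Term → Var → RPL∀
  atom P  [ t / x ] = atom (P [ t / x ]ₐ)
  (A ⊃ B) [ t / x ] = A [ t / x ] ⊃ B [ t / x ]
  all y A [ t / x ] = if does (x ℕₚ.≟ y) then all y A else all y (A [ t / x ])
  ex y A  [ t / x ] = if does (x ℕₚ.≟ y) then ex y A else ex y (A [ t / x ])

  -- Semipropositional variables of type 0 and of type 1.
  data SPVar : Set where
    type0 type1 : ℕ → SPVar

  data Formula : Set where
    rpl : RPL∀ → Formula
    sp  : SPVar → Formula

  data IsAtom : Formula → Set where
    atom : ∀ P → IsAtom (rpl (atom P))
    sp   : ∀ s → IsAtom (sp s)

  data PrenexOrSP : Formula → Set where
    rpl : ∀ {A} → Prenex A → PrenexOrSP (rpl A)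
    sp  : ∀ s → PrenexOrSP (sp s)

  -- Finite multisets are lists, identified up to permutation by _≈_ below.
  Sequent Hypersequent : Set
  Sequent      = List Formula × List Formula
  Hypersequent = List Sequent

  infix 4 _⇒_
  pattern _⇒_ Γ Δ = Γ , Δ

  sequentSetoid : Setoid 0ℓ 0ℓ
  sequentSetoid = ×-setoid (↭-setoid {A = Formula}) (↭-setoid {A = Formula})

  infix 3 _≈_
  _≈_ : Hypersequent → Hypersequent → Set
  _≈_ = PermutationSetoid._↭_ sequentSetoid

  -- P holds of some (every) member of some (every) sequent.
  AnyMember AllMembers : (Formula → Set) → Hypersequent → Set
  AnyMember  P = Any λ (Γ ⇒ Δ) → Any P Γ ⊎ Any P Δ
  AllMembers P = All λ (Γ ⇒ Δ) → All P Γ × All P Δ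

  data ParInTerm (a : Param) : Term → Set where
    par : ParInTerm a (par a)
    app : ∀ {n} (f : Fun n) {ts} → Vec.Any (ParInTerm a) ts → ParInTerm a (app f ts)

  data ParInFormula (a : Param) : RPL∀ → Set where
    pred : ∀ {n} (P : Pred n) {ts} → Vec.Any (ParInTerm a) ts →
           ParInFormula a (atom (pred P ts))
    ⊃ˡ   : ∀ {A B} → ParInFormula a A → ParInFormula a (A ⊃ B)
    ⊃ʳ   : ∀ {A B} → ParInFormula a B → ParInFormula a (A ⊃ B)
    all  : ∀ {A} x → ParInFormula a A → ParInFormula a (all x A)
    ex   : ∀ {A} x → ParInFormula a A → ParInFormula a (ex x A)

  data ParInMember (a : Param) : Formula → Set where
    rpl : ∀ {A} → ParInFormula a A → ParInMember a (rpl A)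

  infix 4 _∉ₚ_ _∉ₛ_
  _∉ₚ_ : Param → Hypersequent → Set
  a ∉ₚ H = ¬ AnyMember (ParInMember a) H

  _∉ₛ_ : SPVar → Hypersequent → Set
  s ∉ₛ H = ¬ AnyMember (sp s ≡_) H

  record HsInterpretation : Set₁ where
    field
      D     : Set
      point : D
      ⟦par⟧  : Param → D
      ⟦fun⟧  : ∀ {n} → Fun n → Vec D n → D
      ⟦pred⟧ : ∀ {n} → Pred n → Vec D n → UnitInterval
      ⟦sp0⟧  : ℕ → NonNegative
      ⟦sp1⟧  : ℕ → AtMostOne

    Valuation : Set
    Valuation = Var → D

    module _ (ν : Valuation) where
      mutual
        ⟦_⟧ₜ : Term → D
        ⟦ var x ⟧ₜ    = ν x
        ⟦ par a ⟧ₜ    = ⟦par⟧ a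
        ⟦ app f ts ⟧ₜ = ⟦fun⟧ f ⟦ ts ⟧ₜₛ

        ⟦_⟧ₜₛ : ∀ {n} → Vec Term n → Vec D n
        ⟦ [] ⟧ₜₛ     = []
        ⟦ t ∷ ts ⟧ₜₛ = ⟦ t ⟧ₜ ∷ ⟦ ts ⟧ₜₛ

      ∣_∣ₐ : ∀ {F} → IsAtom F → ℝ
      ∣ atom (pred P ts) ∣ₐ = proj₁ (⟦pred⟧ P ⟦ ts ⟧ₜₛ)
      ∣ atom (const r) ∣ₐ   = fromℚ (value r)
      ∣ sp (type0 k) ∣ₐ     = proj₁ (⟦sp0⟧ k)
      ∣ sp (type1 k) ∣ₐ     = proj₁ (⟦sp1⟧ k)

      ∣_∣ₘ : ∀ {Γ} → All IsAtom Γ → ℝ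
      ∣ [] ∣ₘ     = 0ᵣ
      ∣ F ∷ Γ ∣ₘ = (∣ F ∣ₐ -ᵣ 1ᵣ) +ᵣ ∣ Γ ∣ₘ

      TrueAtomic : Sequent → Set
      TrueAtomic (Γ ⇒ Δ) =
        Σ[ γ ∈ All IsAtom Γ ] Σ[ δ ∈ All IsAtom Δ ] 0ᵣ ≤ᵣ ∣ δ ∣ₘ -ᵣ ∣ γ ∣ₘ

  -- The existence of a true atomic sequent is meant classically, hence the
  -- double negation: without it not even  F ⇒ G ∣ G ⇒ F  with atoms F and G
  -- would be an axiom, since _≤ᵣ_ is not constructively total.
  Axiom : Hypersequent → Set₁
  Axiom H = (M : HsInterpretation) (ν : HsInterpretation.Valuation M) →
            ¬ ¬ Any (HsInterpretation.TrueAtomic M ν) H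

  infix 2 ⊢_
  data ⊢_ (H : Hypersequent) : Set₁ where
    ax : Axiom H → ⊢ H

    →⇒ : ∀ {𝒢 Γ Δ A B} k →
         H ≈ (rpl (A ⊃ B) ∷ Γ ⇒ Δ) ∷ 𝒢 →
         type1 k ∉ₛ H →
         ⊢ (sp (type1 k) ∷ Γ ⇒ Δ) ∷ (rpl B ∷ [] ⇒ sp (type1 k) ∷ rpl A ∷ []) ∷ 𝒢 →
         ⊢ H

    ⇒→ : ∀ {𝒢 Γ Δ A B} →
         H ≈ (Γ ⇒ rpl (A ⊃ B) ∷ Δ) ∷ 𝒢 →
         ⊢ (Γ ⇒ Δ) ∷ 𝒢 →
         ⊢ (rpl A ∷ Γ ⇒ rpl B ∷ Δ) ∷ 𝒢 →
         ⊢ H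

    ∀⇒ : ∀ {𝒢 Γ Δ x A} k {t} → Closed t →
         H ≈ (rpl (all x A) ∷ Γ ⇒ Δ) ∷ 𝒢 →
         type1 k ∉ₛ H →
         ⊢ (sp (type1 k) ∷ Γ ⇒ Δ) ∷ (rpl (all x A) ∷ [] ⇒ sp (type1 k) ∷ [])
             ∷ (rpl (A [ t / x ]) ∷ [] ⇒ sp (type1 k) ∷ []) ∷ 𝒢 →
         ⊢ H

    ⇒∀ : ∀ {𝒢 Γ Δ x A} a →
         H ≈ (Γ ⇒ rpl (all x A) ∷ Δ) ∷ 𝒢 →
         a ∉ₚ H →
         ⊢ (Γ ⇒ rpl (A [ par a / x ]) ∷ Δ) ∷ 𝒢 →
         ⊢ H

    ⇒∃ : ∀ {𝒢 Γ Δ x A} k {t} → Closed t →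
         H ≈ (Γ ⇒ rpl (ex x A) ∷ Δ) ∷ 𝒢 →
         type0 k ∉ₛ H →
         ⊢ (Γ ⇒ sp (type0 k) ∷ Δ) ∷ (sp (type0 k) ∷ [] ⇒ rpl (ex x A) ∷ [])
             ∷ (sp (type0 k) ∷ [] ⇒ rpl (A [ t / x ]) ∷ []) ∷ 𝒢 →
         ⊢ H

    ∃⇒ : ∀ {𝒢 Γ Δ x A} a →
         H ≈ (rpl (ex x A) ∷ Γ ⇒ Δ) ∷ 𝒢 →
         a ∉ₚ H →
         ⊢ (rpl (A [ par a / x ]) ∷ Γ ⇒ Δ) ∷ 𝒢 →
         ⊢ H

  Q : ∀ {H} → ⊢ H → ℕ
  Q (ax _)         = 0
  Q (→⇒ _ _ _ D)   = Q D
  Q (⇒→ _ D E)     = Q D ℕ.+ Q E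
  Q (∀⇒ _ _ _ _ D) = suc (Q D)
  Q (⇒∀ _ _ _ D)   = suc (Q D)
  Q (⇒∃ _ _ _ _ D) = suc (Q D)
  Q (∃⇒ _ _ _ D)   = suc (Q D)

  -- Q D ≡ 0 says that no quantifier rule is applied in D, that is, above the
  -- propositional rule application of which D proves a premise.
  Mid : ∀ {H} → ⊢ H → Set
  Mid (ax _)         = ⊤
  Mid (→⇒ _ _ _ D)   = Q D ≡ 0 × Mid D
  Mid (⇒→ _ D E)     = (Q D ≡ 0 × Mid D) × (Q E ≡ 0 × Mid E)
  Mid (∀⇒ _ _ _ _ D) = Mid D
  Mid (⇒∀ _ _ _ D)   = Mid D
  Mid (⇒∃ _ _ _ _ D) = Mid D
  Mid (∃⇒ _ _ _ D)   = Mid D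

{-# OPTIONS --safe #-}

-- A proof D of H is replayed, from its root upwards, against a hypersequent w, initially H, to which
-- only quantifier rules are applied.  The conclusion of each step of D is kept covered by w: members
-- that D has decomposed propositionally, and members that w has instantiated earlier (possibly with
-- another parameter), are accounted for semantically, and a quantifier rule of D costs w at most one.
-- At (→⇒) the new variable is read as a value slightly below that of A ⊃ B.  At (⇒→) the premises
-- are replayed one after the other, the first in the models in which A ⊃ B has the value 1 and the
-- second in those in which it has the value 1 − A + B; so the numbers of quantifier rules add up.
-- The axioms of D show that in the end no model falsifies all quantifier-free sequents of w, and the
-- propositional rules prove every such hypersequent.

module Submission where

open import Defs
open import Data.Bool.Base using (if_then_else_; true; false)
open import Data.Empty using (⊥; ⊥-elim)
open import Data.List.Base using (List; []; _∷_; _++_; map)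
open import Data.List.Membership.Propositional using (_∈_; find)
open import Data.List.Membership.Propositional.Properties using (∈-∃++; ∈-++⁻; ∈-map⁻)
open import Data.List.Relation.Binary.Permutation.Propositional
  using (_↭_; refl; prep; swap; ↭-sym; ↭-trans) renaming (trans to transitive)
open import Data.List.Relation.Binary.Permutation.Propositional.Properties
  using (All-resp-↭; ∈-resp-↭; drop-∷; shift; map⁺; ++⁺; ++⁺ˡ)
import Data.List.Relation.Binary.Permutation.Setoid as PermutationSetoid
import Data.List.Relation.Binary.Permutation.Setoid.Properties as PermutationSetoidProperties
open import Data.List.Relation.Binary.Pointwise.Base using (Pointwise; []; _∷_)
open import Data.List.Relation.Unary.All as All using (All; []; _∷_)
import Data.List.Relation.Unary.All.Properties as All
open import Data.List.Relation.Unary.Any as Any using (Any; here; there)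
open import Data.Nat.Base as ℕ using (ℕ; zero; suc; z≤n; s≤s; _≤_)
open import Data.Nat.ListAction using (sum)
open import Data.Nat.ListAction.Properties using (sum-↭)
import Data.Nat.Properties as ℕₚ
import Data.Nat.Solver as ℕ-Solver
open import Data.Product.Base using (Σ-syntax; ∃-syntax; _×_; _,_; proj₁; proj₂)
open import Data.Rational.Base as ℚ using (ℚ; 0ℚ; 1ℚ; ½)
import Data.Rational.Properties as ℚₚ
open import Data.Rational.Solver using (module +-*-Solver)
open import Data.Sum.Base using (_⊎_; inj₁; inj₂; [_,_]′)
open import Data.Unit.Base using (⊤; tt)
open import Data.Vec.Base using (Vec; []; _∷_)
import Data.Vec.Relation.Unary.All as Vec
import Data.Vec.Relation.Unary.Any as Vec
open import Function.Base using (_∘_; id)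
open import Level using (Level)
open import Relation.Binary.Definitions using (DecidableEquality)
open import Relation.Binary.PropositionalEquality
  using (_≡_; _≢_; refl; sym; trans; cong; cong₂; subst; subst₂)
open import Relation.Nullary.Decidable.Core using (Dec; does; yes; no; map′; _⊎-dec_)
open import Relation.Nullary.Negation.Core using (¬_)
open ℕ-Solver.+-*-Solver using ()
  renaming (solve to solveℕ; _:=_ to _:=ℕ_; _:+_ to _:+ℕ_; con to conℕ)
open +-*-Solver using (solve; _:=_; _:+_; :-_; con)

-- The obstacle is the shared context of (⇒→): a quantified formula decomposed while replaying one
-- premise must still be available for the other. For (∀⇒) and (⇒∃) the calculus itself provides the
-- remedy. The new variable stands on opposite sides of the first two premise sequents, so adding
-- their inequalities cancels it and gives back the principal sequent; this is `chain`. The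
-- eigenparameter rules keep no copy, so there the instance itself is shared (`witness`): a
-- parameter of D may be sent to one chosen earlier, because renaming parameters preserves axioms.
--
-- Prenexity makes every implication that D decomposes quantifier-free. Such a formula has a truth
-- value, and no quantified formula ever comes out of a propositional step, so each quantifier
-- inference of D can be traced back to a member of w.
--
-- Falsity is strict, and it is recorded as a rational gap. After (→⇒) the sequent with B on the
-- left must be strictly false too, which forces the new variable below A ⊃ B; half of the gap pays
-- for this in the sequent where the variable is on the left.

-- Arithmetic of rational numbers

half-pos : ∀ {ε} → 0ℚ ℚ.< ε → 0ℚ ℚ.< ½ ℚ.* ε
half-pos {ε} 0<ε = subst (ℚ._< ½ ℚ.* ε) (ℚₚ.*-zeroʳ ½) (ℚₚ.*-monoʳ-<-pos ½ 0<ε)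

half+half : ∀ ε → ½ ℚ.* ε ℚ.+ ½ ℚ.* ε ≡ ε
half+half ε = trans (sym (ℚₚ.*-distribʳ-+ ε ½ ½)) (ℚₚ.*-identityˡ ε)

p≤p+q : ∀ p {q} → 0ℚ ℚ.≤ q → p ℚ.≤ p ℚ.+ q
p≤p+q p {q} 0≤q = subst (ℚ._≤ p ℚ.+ q) (ℚₚ.+-identityʳ p) (ℚₚ.+-monoʳ-≤ p 0≤q)

+-cancelʳ-≤ : ∀ r {p q} → p ℚ.+ r ℚ.≤ q ℚ.+ r → p ℚ.≤ q
+-cancelʳ-≤ r {p} {q} h = subst₂ ℚ._≤_ (lemma p) (lemma q) (ℚₚ.+-monoˡ-≤ (ℚ.- r) h)
  where
  lemma : ∀ p → p ℚ.+ r ℚ.+ ℚ.- r ≡ p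
  lemma p = solve 2 (λ p r → p :+ r :+ (:- r) := p) refl p r

p≤∣p∣ : ∀ p → p ℚ.≤ ℚ.∣ p ∣
p≤∣p∣ p with ℚₚ.≤-total 0ℚ p
... | inj₁ 0≤p = ℚₚ.≤-reflexive (sym (ℚₚ.0≤p⇒∣p∣≡p 0≤p))
... | inj₂ p≤0 = ℚₚ.≤-trans p≤0 (ℚₚ.0≤∣p∣ p)

∣p∣≤ : ∀ {p d} → p ℚ.≤ d → ℚ.- p ℚ.≤ d → ℚ.∣ p ∣ ℚ.≤ d
∣p∣≤ {p} {d} p≤d -p≤d with ℚₚ.∣p∣≡p∨∣p∣≡-p p
... | inj₁ eq = subst (ℚ._≤ d) (sym eq) p≤d
... | inj₂ eq = subst (ℚ._≤ d) (sym eq) -p≤d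

p≤q+∣p-q∣ : ∀ p q → p ℚ.≤ q ℚ.+ ℚ.∣ p ℚ.- q ∣
p≤q+∣p-q∣ p q = subst (ℚ._≤ q ℚ.+ ℚ.∣ p ℚ.- q ∣) (solve 2 (λ p q → q :+ (p :+ (:- q)) := p) refl p q)
  (ℚₚ.+-monoʳ-≤ q (p≤∣p∣ (p ℚ.- q)))

∣p-q∣≡∣q-p∣ : ∀ p q → ℚ.∣ p ℚ.- q ∣ ≡ ℚ.∣ q ℚ.- p ∣
∣p-q∣≡∣q-p∣ p q = trans (sym (ℚₚ.∣-p∣≡∣p∣ (p ℚ.- q)))
  (cong ℚ.∣_∣ (solve 2 (λ p q → :- (p :+ (:- q)) := q :+ (:- p)) refl p q))

⊓-nonexpansive : ∀ r p q → ℚ.∣ (r ℚ.⊓ p) ℚ.- (r ℚ.⊓ q) ∣ ℚ.≤ ℚ.∣ p ℚ.- q ∣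
⊓-nonexpansive r p q = ∣p∣≤ (bound p q)
  (subst₂ ℚ._≤_ (solve 2 (λ a b → b :+ (:- a) := :- (a :+ (:- b))) refl (r ℚ.⊓ p) (r ℚ.⊓ q))
    (∣p-q∣≡∣q-p∣ q p) (bound q p))
  where
  shifted : ∀ p q → r ℚ.⊓ p ℚ.≤ (r ℚ.⊓ q) ℚ.+ ℚ.∣ p ℚ.- q ∣
  shifted p q with ℚₚ.⊓-sel r q
  ... | inj₁ eq = subst (λ z → r ℚ.⊓ p ℚ.≤ z ℚ.+ _) (sym eq)
    (ℚₚ.≤-trans (ℚₚ.p⊓q≤p r p) (p≤p+q r (ℚₚ.0≤∣p∣ (p ℚ.- q))))
  ... | inj₂ eq = subst (λ z → r ℚ.⊓ p ℚ.≤ z ℚ.+ _) (sym eq)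
    (ℚₚ.≤-trans (ℚₚ.p⊓q≤q r p) (p≤q+∣p-q∣ p q))
  bound : ∀ p q → (r ℚ.⊓ p) ℚ.- (r ℚ.⊓ q) ℚ.≤ ℚ.∣ p ℚ.- q ∣
  bound p q = +-cancelʳ-≤ (r ℚ.⊓ q) (subst₂ ℚ._≤_
    (solve 2 (λ a b → a := a :+ (:- b) :+ b) refl (r ℚ.⊓ p) (r ℚ.⊓ q))
    (ℚₚ.+-comm (r ℚ.⊓ q) _) (shifted p q))

⊓-pos : ∀ {p q} → 0ℚ ℚ.< p → 0ℚ ℚ.< q → 0ℚ ℚ.< p ℚ.⊓ q
⊓-pos {p} {q} 0<p 0<q = [ (λ eq → subst (0ℚ ℚ.<_) (sym eq) 0<p)
                        , (λ eq → subst (0ℚ ℚ.<_) (sym eq) 0<q) ]′ (ℚₚ.⊓-sel p q)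

-- The order of the Cauchy reals

-- A record, so that both sides can be inferred.
infix 4 _≼_
record _≼_ (x y : ℝ) : Set where
  constructor ≼-intro
  field ≼-elim : x ≤ᵣ y
open _≼_ public

pointwise⇒≼ : ∀ {x y} → (∀ n → seq x n ℚ.≤ seq y n) → x ≼ y
pointwise⇒≼ {x} {y} h = ≼-intro λ ε 0<ε → 0 , λ n _ → ℚₚ.≤-trans (h n) (p≤p+q (seq y n) (ℚₚ.<⇒≤ 0<ε))

≼-refl : ∀ x → x ≼ x
≼-refl x = pointwise⇒≼ λ _ → ℚₚ.≤-refl

fromℚ-mono-≼ : ∀ {p q} → p ℚ.≤ q → fromℚ p ≼ fromℚ q
fromℚ-mono-≼ p≤q = pointwise⇒≼ λ _ → p≤q

≡⇒≼ : ∀ {x y} → (∀ n → seq x n ≡ seq y n) → x ≼ y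
≡⇒≼ h = pointwise⇒≼ λ n → ℚₚ.≤-reflexive (h n)

infixl 6 _⊕_
_⊕_ : ∀ {w x y z} → w ≼ x → y ≼ z → w +ᵣ y ≼ x +ᵣ z
_⊕_ {w} {x} {y} {z} (≼-intro w≤x) (≼-intro y≤z) = ≼-intro λ ε 0<ε →
  let M , p = w≤x (½ ℚ.* ε) (half-pos 0<ε)
      N , q = y≤z (½ ℚ.* ε) (half-pos 0<ε)
  in M ℕ.⊔ N , λ n n≥ → ℚₚ.≤-trans
    (ℚₚ.+-mono-≤ (p n (ℕₚ.m⊔n≤o⇒m≤o M N n≥)) (q n (ℕₚ.m⊔n≤o⇒n≤o M N n≥)))
    (ℚₚ.≤-reflexive (trans
      (solve 3 (λ a b h → a :+ h :+ (b :+ h) := a :+ b :+ (h :+ h)) refl (seq x n) (seq z n) (½ ℚ.* ε))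
      (cong (seq x n ℚ.+ seq z n ℚ.+_) (half+half ε))))

-- Linear arithmetic: the hypothesis is typically a sum of inequalities, formed with _⊕_.
linear : ∀ {w x y z} → x ≼ y → (∀ n → seq w n ℚ.+ seq y n ≡ seq x n ℚ.+ seq z n) → w ≼ z
linear {w} {x} {y} {z} (≼-intro h) eq = ≼-intro λ ε 0<ε →
  let N , p = h ε 0<ε
  in N , λ n n≥ → +-cancelʳ-≤ (seq y n) (subst₂ ℚ._≤_ (sym (eq n))
    (solve 3 (λ y z ε → y :+ ε :+ z := z :+ ε :+ y) refl (seq y n) (seq z n) ε)
    (ℚₚ.+-monoˡ-≤ (seq z n) (p n n≥)))

≼-trans : ∀ {x y z} → x ≼ y → y ≼ z → x ≼ z
≼-trans {x} {y} {z} x≼y y≼z = linear (x≼y ⊕ y≼z)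
  λ n → sym (ℚₚ.+-assoc (seq x n) (seq y n) (seq z n))

positive⋠0 : ∀ {δ} → 0ℚ ℚ.< δ → ¬ (fromℚ δ ≼ 0ᵣ)
positive⋠0 {δ} 0<δ (≼-intro h) =
  let N , p = h (½ ℚ.* δ) (half-pos 0<δ)
      δ≤½δ  = subst (δ ℚ.≤_) (ℚₚ.+-identityˡ (½ ℚ.* δ)) (p N ℕₚ.≤-refl)
      ½δ≤0  = +-cancelʳ-≤ (½ ℚ.* δ) (subst₂ ℚ._≤_ (sym (half+half δ)) (sym (ℚₚ.+-identityˡ (½ ℚ.* δ))) δ≤½δ)
  in ℚₚ.<-irrefl refl (ℚₚ.<-≤-trans (half-pos 0<δ) ½δ≤0)

half : ∀ {ε} → 0ℚ ℚ.< ε → ∃[ η ] (0ℚ ℚ.< η × η ℚ.+ η ≡ ε)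
half {ε} 0<ε = ½ ℚ.* ε , half-pos 0<ε , half+half ε

-- Given `ε`, write it as `δ` plus four times `η` and compare both sequences at an index `N` beyond
-- which each varies by less than `η`. If x exceeds y there by `δ` plus two `η`, the gap `δ`
-- persists at all later indices; otherwise x stays below y plus `ε`. The double negation allows the
-- first outcome to be refuted for each `ε`.
≼-or-gap : ∀ x y → ¬ ¬ (x ≼ y ⊎ ∃[ δ ] (0ℚ ℚ.< δ × y +ᵣ fromℚ δ ≼ x))
≼-or-gap x y refuted = refuted (inj₁ (≼-intro x≤y))
  where
  near : ∀ {p q η} → ℚ.∣ p ℚ.- q ∣ ℚ.< η → p ℚ.≤ q ℚ.+ η
  near {p} {q} h = ℚₚ.≤-trans (p≤q+∣p-q∣ p q) (ℚₚ.+-monoʳ-≤ q (ℚₚ.<⇒≤ h))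
  module _ (η δ : ℚ) (0<η : 0ℚ ℚ.< η) (0<δ : 0ℚ ℚ.< δ) where
    Nx = proj₁ (cauchy x η 0<η)
    Ny = proj₁ (cauchy y η 0<η)
    N = Nx ℕ.⊔ Ny
    module _ {m n} (m≥ : N ℕ.≤ m) (n≥ : N ℕ.≤ n) where
      nearˣ : seq x m ℚ.≤ seq x n ℚ.+ η
      nearˣ = near (proj₂ (cauchy x η 0<η) m n (ℕₚ.m⊔n≤o⇒m≤o Nx Ny m≥) (ℕₚ.m⊔n≤o⇒m≤o Nx Ny n≥))
      nearʸ : seq y m ℚ.≤ seq y n ℚ.+ η
      nearʸ = near (proj₂ (cauchy y η 0<η) m n (ℕₚ.m⊔n≤o⇒n≤o Nx Ny m≥) (ℕₚ.m⊔n≤o⇒n≤o Nx Ny n≥))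
    far⇒gap : ∀ {n} → N ℕ.≤ n → seq y N ℚ.+ (δ ℚ.+ (η ℚ.+ η)) ℚ.≤ seq x N → seq y n ℚ.+ δ ℚ.≤ seq x n
    far⇒gap {n} n≥ far = +-cancelʳ-≤ η (ℚₚ.≤-trans
      (subst₂ ℚ._≤_
        (solve 3 (λ y δ η → y :+ (δ :+ η) := y :+ δ :+ η) refl (seq y n) δ η)
        (solve 3 (λ y δ η → y :+ η :+ (δ :+ η) := y :+ (δ :+ (η :+ η))) refl (seq y N) δ η)
        (ℚₚ.+-monoˡ-≤ (δ ℚ.+ η) (nearʸ n≥ ℕₚ.≤-refl)))
      (ℚₚ.≤-trans far (nearˣ ℕₚ.≤-refl n≥)))
    close⇒≤ : ∀ {n} → N ℕ.≤ n → seq x N ℚ.≤ seq y N ℚ.+ (δ ℚ.+ (η ℚ.+ η)) →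
              seq x n ℚ.≤ seq y n ℚ.+ (δ ℚ.+ (η ℚ.+ η ℚ.+ (η ℚ.+ η)))
    close⇒≤ {n} n≥ close = ℚₚ.≤-trans (nearˣ n≥ ℕₚ.≤-refl)
      (ℚₚ.≤-trans (ℚₚ.+-monoˡ-≤ η close)
      (subst₂ ℚ._≤_ refl
        (solve 4 (λ y δ η ζ → y :+ η :+ (δ :+ ζ) :+ η := y :+ (δ :+ (ζ :+ (η :+ η)))) refl
          (seq y n) δ η (η ℚ.+ η))
        (ℚₚ.+-monoˡ-≤ η (ℚₚ.+-monoˡ-≤ (δ ℚ.+ (η ℚ.+ η)) (nearʸ ℕₚ.≤-refl n≥)))))
    close : seq x N ℚ.≤ seq y N ℚ.+ (δ ℚ.+ (η ℚ.+ η))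
    close = [ (λ h → h) , (λ far → ⊥-elim (refuted (inj₂ (δ , 0<δ , ≼-intro (gap far))))) ]′
      (ℚₚ.≤-total (seq x N) (seq y N ℚ.+ (δ ℚ.+ (η ℚ.+ η))))
      where
      gap : seq y N ℚ.+ (δ ℚ.+ (η ℚ.+ η)) ℚ.≤ seq x N → y +ᵣ fromℚ δ ≤ᵣ x
      gap far ε 0<ε = N , λ n n≥ → ℚₚ.≤-trans (far⇒gap n≥ far) (p≤p+q (seq x n) (ℚₚ.<⇒≤ 0<ε))
  x≤y : x ≤ᵣ y
  x≤y ε 0<ε with half 0<ε
  ... | δ , 0<δ , refl with half 0<δ
  ...   | _ , 0<b , refl with half 0<b
  ...     | η , 0<η , refl = N η δ 0<η 0<δ , λ n n≥ → close⇒≤ η δ 0<η 0<δ n≥ (close η δ 0<η 0<δ)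

x≼x+δ : ∀ {x δ} → 0ℚ ℚ.≤ δ → x ≼ x +ᵣ fromℚ δ
x≼x+δ {x} 0≤δ = pointwise⇒≼ λ n → p≤p+q (seq x n) 0≤δ

≼-total : ∀ x y → ¬ ¬ (x ≼ y ⊎ y ≼ x)
≼-total x y refuted = ≼-or-gap x y λ where
  (inj₁ x≼y)               → refuted (inj₁ x≼y)
  (inj₂ (δ , 0<δ , y+δ≼x)) → refuted (inj₂ (≼-trans (x≼x+δ (ℚₚ.<⇒≤ 0<δ)) y+δ≼x))

-- Łukasiewicz implication on the reals

1⊓ᵣ_ : ℝ → ℝ
(1⊓ᵣ x) .seq n = 1ℚ ℚ.⊓ seq x n
(1⊓ᵣ x) .cauchy ε 0<ε =
  let N , p = cauchy x ε 0<ε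
  in N , λ m n m≥ n≥ → ℚₚ.≤-<-trans (⊓-nonexpansive 1ℚ (seq x m) (seq x n)) (p m n m≥ n≥)

infixr 6 _⊃ᵣ_
_⊃ᵣ_ : ℝ → ℝ → ℝ
x ⊃ᵣ y = 1⊓ᵣ (1ᵣ -ᵣ x +ᵣ y)

⊃ᵣ≼1 : ∀ x y → x ⊃ᵣ y ≼ 1ᵣ
⊃ᵣ≼1 x y = pointwise⇒≼ λ n → ℚₚ.p⊓q≤p 1ℚ (seq (1ᵣ -ᵣ x +ᵣ y) n)

⊃ᵣ≼ : ∀ x y → x ⊃ᵣ y ≼ 1ᵣ -ᵣ x +ᵣ y
⊃ᵣ≼ x y = pointwise⇒≼ λ n → ℚₚ.p⊓q≤q 1ℚ (seq (1ᵣ -ᵣ x +ᵣ y) n)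

1⊓ᵣ-cases : ∀ x → ¬ ¬ (1ᵣ ≼ 1⊓ᵣ x ⊎ x ≼ 1⊓ᵣ x)
1⊓ᵣ-cases x refuted = ≼-total 1ᵣ x λ where
    (inj₁ (≼-intro 1≤x)) → refuted (inj₁ (≼-intro λ ε 0<ε → let N , p = 1≤x ε 0<ε in N , λ n n≥ →
      below 1ℚ (seq x n) 1ℚ ε (p≤p+q 1ℚ (ℚₚ.<⇒≤ 0<ε)) (p n n≥)))
    (inj₂ (≼-intro x≤1)) → refuted (inj₂ (≼-intro λ ε 0<ε → let N , p = x≤1 ε 0<ε in N , λ n n≥ →
      below 1ℚ (seq x n) (seq x n) ε (p n n≥) (p≤p+q (seq x n) (ℚₚ.<⇒≤ 0<ε))))
  where
  below : ∀ p q r ε → r ℚ.≤ p ℚ.+ ε → r ℚ.≤ q ℚ.+ ε → r ℚ.≤ (p ℚ.⊓ q) ℚ.+ ε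
  below p q r ε h₁ h₂ = [ (λ eq → subst (λ z → r ℚ.≤ z ℚ.+ ε) (sym eq) h₁)
                        , (λ eq → subst (λ z → r ℚ.≤ z ℚ.+ ε) (sym eq) h₂) ]′ (ℚₚ.⊓-sel p q)

-- Only the lower bounds are stated, since `⊃ᵣ≼1` and `⊃ᵣ≼` supply the upper ones: the implication
-- equals one of the two arguments of the minimum.
⊃ᵣ-cases : ∀ x y → ¬ ¬ (1ᵣ ≼ x ⊃ᵣ y ⊎ 1ᵣ -ᵣ x +ᵣ y ≼ x ⊃ᵣ y)
⊃ᵣ-cases x y = 1⊓ᵣ-cases (1ᵣ -ᵣ x +ᵣ y)

-- Inequalities behind the propositional rules

-- Sums are specified pointwise below, because comparing compound real numbers for definitional
-- equality is expensive: it extends to the proofs of the Cauchy property.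

left-mono : ∀ i p y {x z} → (∀ n → seq x n ≡ 1ℚ ℚ.- seq i n ℚ.+ seq y n) →
            (∀ n → seq z n ≡ 1ℚ ℚ.- seq p n ℚ.+ seq y n) → 0ᵣ ≼ x → p ≼ i → 0ᵣ ≼ z
left-mono i p y eqx eqz h p≼i = linear (h ⊕ p≼i) λ n →
  trans (cong (λ x → 0ℚ ℚ.+ (x ℚ.+ seq i n)) (eqx n)) (
  trans (solve 5 (λ z o i y p → z :+ (o :+ (:- i) :+ y :+ i) := z :+ p :+ (o :+ (:- p) :+ y)) refl
    0ℚ 1ℚ (seq i n) (seq y n) (seq p n)) (cong (0ℚ ℚ.+ seq p n ℚ.+_) (sym (eqz n))))

right-drop : ∀ i y {x} → (∀ n → seq x n ≡ seq i n ℚ.- 1ℚ ℚ.+ seq y n) → 0ᵣ ≼ x → i ≼ 1ᵣ → 0ᵣ ≼ y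
right-drop i y eqx h i≼1 = linear (h ⊕ i≼1) λ n →
  trans (cong (λ x → 0ℚ ℚ.+ (x ℚ.+ 1ℚ)) (eqx n))
        (solve 4 (λ z o i y → z :+ (i :+ (:- o) :+ y :+ o) := z :+ i :+ y) refl
          0ℚ 1ℚ (seq i n) (seq y n))

right-split : ∀ a b y {x z} → (∀ n → seq x n ≡ seq (a ⊃ᵣ b) n ℚ.- 1ℚ ℚ.+ seq y n) →
              (∀ n → seq z n ≡ 1ℚ ℚ.- seq a n ℚ.+ (seq b n ℚ.- 1ℚ ℚ.+ seq y n)) → 0ᵣ ≼ x → 0ᵣ ≼ z
right-split a b y eqx eqz h = linear (h ⊕ ⊃ᵣ≼ a b) λ n →
  trans (cong (λ x → 0ℚ ℚ.+ (x ℚ.+ (1ℚ ℚ.- seq a n ℚ.+ seq b n))) (eqx n)) (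
  trans (solve 6 (λ z o i y a b → z :+ (i :+ (:- o) :+ y :+ (o :+ (:- a) :+ b)) :=
                             z :+ i :+ (o :+ (:- a) :+ (b :+ (:- o) :+ y))) refl
      0ℚ 1ℚ (seq (a ⊃ᵣ b) n) (seq y n) (seq a n) (seq b n)) (cong (0ℚ ℚ.+ seq (a ⊃ᵣ b) n ℚ.+_) (sym (eqz n))))

residual : ∀ a b p {z} → (∀ n → seq z n ≡ 1ℚ ℚ.- seq b n ℚ.+ (seq p n ℚ.- 1ℚ ℚ.+ (seq a n ℚ.- 1ℚ ℚ.+ 0ℚ))) →
           1ᵣ -ᵣ a +ᵣ b ≼ p → 0ᵣ ≼ z
residual a b p eqz h = linear h λ n → trans
  (solve 5 (λ z o p a b → z :+ p := o :+ (:- a) :+ b :+ (o :+ (:- b) :+ (p :+ (:- o) :+ (a :+ (:- o) :+ z))))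
    refl 0ℚ 1ℚ (seq p n) (seq a n) (seq b n)) (cong (1ℚ ℚ.- seq a n ℚ.+ seq b n ℚ.+_) (sym (eqz n)))

⊃ᵣ-lower≤1 : ∀ a b {δ} → 0ℚ ℚ.≤ δ → (a ⊃ᵣ b) -ᵣ fromℚ δ ≤ᵣ 1ᵣ
⊃ᵣ-lower≤1 a b {δ} 0≤δ = ≼-elim {(a ⊃ᵣ b) -ᵣ fromℚ δ} {1ᵣ} (linear (⊃ᵣ≼1 a b ⊕ fromℚ-mono-≼ 0≤δ) λ n →
  solve 3 (λ i d o → i :+ (:- d) :+ (o :+ d) := i :+ con 0ℚ :+ o) refl (seq (a ⊃ᵣ b) n) δ 1ℚ)

left-lower : ∀ i δ δ′ {x z} → δ′ ℚ.+ δ′ ≡ δ → (∀ n → seq x n ≡ 1ℚ ℚ.- (seq i n ℚ.- δ′) ℚ.+ 0ℚ ℚ.+ δ′) →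
             (∀ n → seq z n ≡ 1ℚ ℚ.- seq i n ℚ.+ 0ℚ ℚ.+ δ) → x ≼ z
left-lower i δ δ′ eq eqx eqz = ≡⇒≼ λ n → trans (eqx n) (trans
  (solve 3 (λ o i d → o :+ (:- (i :+ (:- d))) :+ con 0ℚ :+ d := o :+ (:- i) :+ con 0ℚ :+ (d :+ d)) refl
    1ℚ (seq i n) δ′)
  (trans (cong (1ℚ ℚ.- seq i n ℚ.+ 0ℚ ℚ.+_) eq) (sym (eqz n))))

residual-lower : ∀ a b δ {x} →
  (∀ n → seq x n ≡ 1ℚ ℚ.- seq b n ℚ.+ (seq (a ⊃ᵣ b) n ℚ.- δ ℚ.- 1ℚ ℚ.+ (seq a n ℚ.- 1ℚ ℚ.+ 0ℚ)) ℚ.+ δ) →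
  x ≼ 0ᵣ
residual-lower a b δ eqx = linear (⊃ᵣ≼ a b) λ n → trans
  (cong (ℚ._+ (1ℚ ℚ.- seq a n ℚ.+ seq b n)) (eqx n))
  (solve 5 (λ o a b i d → o :+ (:- b) :+ (i :+ (:- d) :+ (:- o) :+ (a :+ (:- o) :+ con 0ℚ)) :+ d :+
      (o :+ (:- a) :+ b) := i :+ con 0ℚ) refl 1ℚ (seq a n) (seq b n) (seq (a ⊃ᵣ b) n) δ)

right-top : ∀ i δ {x z} → (∀ n → seq x n ≡ 0ℚ ℚ.+ δ) → (∀ n → seq z n ≡ seq i n ℚ.- 1ℚ ℚ.+ 0ℚ ℚ.+ δ) →
            1ᵣ ≼ i → x ≼ z
right-top i δ eqx eqz h = linear h λ n → trans (cong (ℚ._+ seq i n) (eqx n)) (trans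
  (solve 3 (λ o i d → con 0ℚ :+ d :+ i := o :+ (i :+ (:- o) :+ con 0ℚ :+ d)) refl 1ℚ (seq i n) δ)
  (cong (1ℚ ℚ.+_) (sym (eqz n))))

right-below : ∀ a b i δ {x z} → (∀ n → seq x n ≡ 1ℚ ℚ.- seq a n ℚ.+ (seq b n ℚ.- 1ℚ ℚ.+ 0ℚ) ℚ.+ δ) →
              (∀ n → seq z n ≡ seq i n ℚ.- 1ℚ ℚ.+ 0ℚ ℚ.+ δ) → 1ᵣ -ᵣ a +ᵣ b ≼ i → x ≼ z
right-below a b i δ eqx eqz h = linear h λ n → trans (cong (ℚ._+ seq i n) (eqx n)) (trans
  (solve 5 (λ o a b i d → o :+ (:- a) :+ (b :+ (:- o) :+ con 0ℚ) :+ d :+ i :=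
      o :+ (:- a) :+ b :+ (i :+ (:- o) :+ con 0ℚ :+ d)) refl 1ℚ (seq a n) (seq b n) (seq i n) δ)
  (cong (1ℚ ℚ.- seq a n ℚ.+ seq b n ℚ.+_) (sym (eqz n))))

-- Function update and permutations

private variable
  ℓ ℓ′ : Level
  A : Set ℓ
  B : Set ℓ′

update : DecidableEquality A → A → B → (A → B) → A → B
update _≟_ x y f z = if does (x ≟ z) then y else f z

update-same : (_≟_ : DecidableEquality A) (x : A) (y : B) (f : A → B) → update _≟_ x y f x ≡ y
update-same _≟_ x y f with x ≟ x
... | yes _  = refl
... | no x≢x = ⊥-elim (x≢x refl)

update-other : (_≟_ : DecidableEquality A) {x : A} (y : B) (f : A → B) {z : A} →
               x ≢ z → f z ≡ update _≟_ x y f z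
update-other _≟_ {x} y f {z} x≢z with x ≟ z
... | yes x≡z = ⊥-elim (x≢z x≡z)
... | no _    = refl

∈⇒↭ : {x : A} {xs : List A} → x ∈ xs → ∃[ ys ] xs ↭ x ∷ ys
∈⇒↭ x∈xs with ∈-∃++ x∈xs
... | ys , zs , refl = ys ++ zs , shift _ ys zs

-- Decides whether the formula that D decomposes is the one on which a constructor of `Covers` acts
-- or lies in the rest of its sequent.
∷-↭-∷ : {x y : A} {xs ys : List A} → x ∷ xs ↭ y ∷ ys →
        (x ≡ y × xs ↭ ys) ⊎ ∃[ zs ] (xs ↭ y ∷ zs × ys ↭ x ∷ zs)
∷-↭-∷ {x = x} {y} p with ∈-resp-↭ (↭-sym p) (here refl)
... | here refl  = inj₁ (refl , drop-∷ p)
... | there y∈xs with ∈⇒↭ y∈xs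
...   | zs , q = inj₂ (zs , q , drop-∷ (↭-trans (↭-sym p) (↭-trans (prep x q) (swap x y refl))))

data Side : Set where
  L R : Side

opposite : Side → Side
opposite L = R
opposite R = L

module Proof (Sig : Signature) where
  open Signature Sig
  open Calculus Sig

  module ≈ₛ = PermutationSetoid sequentSetoid
  module ≈ₚ = PermutationSetoidProperties sequentSetoid

  infix 4 _≈ₛ_
  _≈ₛ_ : Sequent → Sequent → Set
  (Γ ⇒ Δ) ≈ₛ (Γ′ ⇒ Δ′) = Γ ↭ Γ′ × Δ ↭ Δ′

  -- Renaming of parameters

  mutual
    renameₜ : (Param → Param) → Term → Term
    renameₜ σ (var x)    = var x
    renameₜ σ (par a)    = par (σ a)
    renameₜ σ (app f ts) = app f (renameₜₛ σ ts)

    renameₜₛ : ∀ {n} → (Param → Param) → Vec Term n → Vec Term n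
    renameₜₛ σ []       = []
    renameₜₛ σ (t ∷ ts) = renameₜ σ t ∷ renameₜₛ σ ts

  renameₐ : (Param → Param) → Atomic → Atomic
  renameₐ σ (pred P ts) = pred P (renameₜₛ σ ts)
  renameₐ σ (const r)   = const r

  rename : (Param → Param) → RPL∀ → RPL∀
  rename σ (atom P)  = atom (renameₐ σ P)
  rename σ (A ⊃ B)   = rename σ A ⊃ rename σ B
  rename σ (all x A) = all x (rename σ A)
  rename σ (ex x A)  = ex x (rename σ A)

  mutual
    renameₜ-cong : ∀ {σ τ} t → (∀ a → ParInTerm a t → σ a ≡ τ a) → renameₜ σ t ≡ renameₜ τ t
    renameₜ-cong (var x)    h = refl
    renameₜ-cong (par a)    h = cong par (h a (par))
    renameₜ-cong (app f ts) h = cong (app f) (renameₜₛ-cong ts λ a p → h a (app f p))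

    renameₜₛ-cong : ∀ {n σ τ} (ts : Vec Term n) → (∀ a → Vec.Any (ParInTerm a) ts → σ a ≡ τ a) →
                    renameₜₛ σ ts ≡ renameₜₛ τ ts
    renameₜₛ-cong []       h = refl
    renameₜₛ-cong (t ∷ ts) h = cong₂ _∷_ (renameₜ-cong t λ a p → h a (Vec.here p))
                                         (renameₜₛ-cong ts λ a p → h a (Vec.there p))

  rename-cong : ∀ {σ τ} A → (∀ a → ParInFormula a A → σ a ≡ τ a) → rename σ A ≡ rename τ A
  rename-cong (atom (pred P ts)) h = cong (λ ts → atom (pred P ts)) (renameₜₛ-cong ts λ a p → h a (pred P p))
  rename-cong (atom (const r))   h = refl
  rename-cong (A ⊃ B)   h = cong₂ _⊃_ (rename-cong A λ a p → h a (⊃ˡ p)) (rename-cong B λ a p → h a (⊃ʳ p))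
  rename-cong (all x A) h = cong (all x) (rename-cong A λ a p → h a (all x p))
  rename-cong (ex x A)  h = cong (ex x) (rename-cong A λ a p → h a (ex x p))

  mutual
    renameₜ-id : ∀ t → renameₜ id t ≡ t
    renameₜ-id (var x)    = refl
    renameₜ-id (par a)    = refl
    renameₜ-id (app f ts) = cong (app f) (renameₜₛ-id ts)

    renameₜₛ-id : ∀ {n} (ts : Vec Term n) → renameₜₛ id ts ≡ ts
    renameₜₛ-id []       = refl
    renameₜₛ-id (t ∷ ts) = cong₂ _∷_ (renameₜ-id t) (renameₜₛ-id ts)

  rename-id : ∀ A → rename id A ≡ A
  rename-id (atom (pred P ts)) = cong (λ ts → atom (pred P ts)) (renameₜₛ-id ts)
  rename-id (atom (const r))   = refl
  rename-id (A ⊃ B)   = cong₂ _⊃_ (rename-id A) (rename-id B)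
  rename-id (all x A) = cong (all x) (rename-id A)
  rename-id (ex x A)  = cong (ex x) (rename-id A)

  module _ (σ : Param → Param) (t : Term) (x : Var) where
    mutual
      renameₜ-subst : ∀ s → renameₜ σ (s [ t / x ]ₜ) ≡ renameₜ σ s [ renameₜ σ t / x ]ₜ
      renameₜ-subst (var y) with does (x ℕₚ.≟ y)
      ... | true  = refl
      ... | false = refl
      renameₜ-subst (par a)    = refl
      renameₜ-subst (app f ts) = cong (app f) (renameₜₛ-subst ts)

      renameₜₛ-subst : ∀ {n} (ts : Vec Term n) →
                       renameₜₛ σ (ts [ t / x ]ₜₛ) ≡ renameₜₛ σ ts [ renameₜ σ t / x ]ₜₛ
      renameₜₛ-subst []       = refl
      renameₜₛ-subst (s ∷ ts) = cong₂ _∷_ (renameₜ-subst s) (renameₜₛ-subst ts)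

    rename-subst : ∀ A → rename σ (A [ t / x ]) ≡ rename σ A [ renameₜ σ t / x ]
    rename-subst (atom (pred P ts)) = cong (λ ts → atom (pred P ts)) (renameₜₛ-subst ts)
    rename-subst (atom (const r))   = refl
    rename-subst (A ⊃ B) = cong₂ _⊃_ (rename-subst A) (rename-subst B)
    rename-subst (all y A) with does (x ℕₚ.≟ y)
    ... | true  = refl
    ... | false = cong (all y) (rename-subst A)
    rename-subst (ex y A) with does (x ℕₚ.≟ y)
    ... | true  = refl
    ... | false = cong (ex y) (rename-subst A)

  mutual
    rename-closed : ∀ σ {t} → Closed t → Closed (renameₜ σ t)
    rename-closed σ (par a)    = par (σ a)
    rename-closed σ (app f cs) = app f (renameₜₛ-closed σ cs)

    renameₜₛ-closed : ∀ {n} σ {ts : Vec Term n} → Vec.All Closed ts → Vec.All Closed (renameₜₛ σ ts)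
    renameₜₛ-closed σ Vec.[]       = Vec.[]
    renameₜₛ-closed σ (c Vec.∷ cs) = rename-closed σ c Vec.∷ renameₜₛ-closed σ cs

  rename-quantifierFree : ∀ σ {A} → QuantifierFree A → QuantifierFree (rename σ A)
  rename-quantifierFree σ (atom P) = atom (renameₐ σ P)
  rename-quantifierFree σ (p ⊃ q)  = rename-quantifierFree σ p ⊃ rename-quantifierFree σ q

  subst-quantifierFree : ∀ {A} t x → QuantifierFree A → QuantifierFree (A [ t / x ])
  subst-quantifierFree t x (atom P) = atom (P [ t / x ]ₐ)
  subst-quantifierFree t x (p ⊃ q)  = subst-quantifierFree t x p ⊃ subst-quantifierFree t x q

  subst-prenex : ∀ {A} t x → Prenex A → Prenex (A [ t / x ])
  subst-prenex t x (qf p) = qf (subst-quantifierFree t x p)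
  subst-prenex t x (all y p) with does (x ℕₚ.≟ y)
  ... | true  = all y p
  ... | false = all y (subst-prenex t x p)
  subst-prenex t x (ex y p) with does (x ℕₚ.≟ y)
  ... | true  = ex y p
  ... | false = ex y (subst-prenex t x p)

  -- This is how prenexity enters: both sides of a principal implication have truth values.
  prenex-⊃ : ∀ {A B} → Prenex (A ⊃ B) → QuantifierFree A × QuantifierFree B
  prenex-⊃ (qf (p ⊃ q)) = p , q

  -- Fresh symbols

  either-bound : ∀ {P Q : ℕ → Set} → ∃[ N ] (∀ {n} → P n → n ℕ.< N) → ∃[ N ] (∀ {n} → Q n → n ℕ.< N) →
                 ∃[ N ] (∀ {n} → P n ⊎ Q n → n ℕ.< N)
  either-bound (M , p) (N , q) = M ℕ.⊔ N , λ where
    (inj₁ x) → ℕₚ.<-≤-trans (p x) (ℕₚ.m≤m⊔n M N)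
    (inj₂ y) → ℕₚ.<-≤-trans (q y) (ℕₚ.m≤n⊔m M N)

  map-bound : ∀ {P Q : ℕ → Set} → (∀ {n} → Q n → P n) → ∃[ N ] (∀ {n} → P n → n ℕ.< N) →
              ∃[ N ] (∀ {n} → Q n → n ℕ.< N)
  map-bound f (N , p) = N , p ∘ f

  mutual
    boundₜ : ∀ t → ∃[ N ] (∀ {a} → ParInTerm a t → a ℕ.< N)
    boundₜ (var x)    = 0 , λ ()
    boundₜ (par a)    = suc a , λ where par → ℕₚ.n<1+n a
    boundₜ (app f ts) = map-bound (λ where (app _ p) → p) (boundₜₛ ts)

    boundₜₛ : ∀ {n} (ts : Vec Term n) → ∃[ N ] (∀ {a} → Vec.Any (ParInTerm a) ts → a ℕ.< N)
    boundₜₛ []       = 0 , λ ()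
    boundₜₛ (t ∷ ts) = map-bound (λ where (Vec.here p) → inj₁ p
                                          (Vec.there p) → inj₂ p) (either-bound (boundₜ t) (boundₜₛ ts))

  param-bound : ∀ A → ∃[ N ] (∀ {a} → ParInFormula a A → a ℕ.< N)
  param-bound (atom (pred P ts)) = map-bound (λ where (pred _ p) → p) (boundₜₛ ts)
  param-bound (atom (const r))   = 0 , λ ()
  param-bound (A ⊃ B)   = map-bound (λ where (⊃ˡ p) → inj₁ p
                                             (⊃ʳ p) → inj₂ p) (either-bound (param-bound A) (param-bound B))
  param-bound (all x A) = map-bound (λ where (all _ p) → p) (param-bound A)
  param-bound (ex x A)  = map-bound (λ where (ex _ p) → p) (param-bound A)

  any-bound : ∀ {X : Set} {P : ℕ → X → Set} → (∀ x → ∃[ N ] (∀ {n} → P n x → n ℕ.< N)) →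
              ∀ xs → ∃[ N ] (∀ {n} → Any (P n) xs → n ℕ.< N)
  any-bound f []       = 0 , λ ()
  any-bound f (x ∷ xs) = map-bound (λ where (here p) → inj₁ p
                                            (there p) → inj₂ p) (either-bound (f x) (any-bound f xs))

  fresh : ∀ {P : ℕ → Formula → Set} → (∀ F → ∃[ N ] (∀ {n} → P n F → n ℕ.< N)) →
          ∀ H → ∃[ n ] ¬ AnyMember (P n) H
  fresh f H with any-bound (λ (Γ ⇒ Δ) → either-bound (any-bound f Γ) (any-bound f Δ)) H
  ... | N , p = N , λ q → ℕₚ.<-irrefl refl (p q)

  freshParam : ∀ H → ∃[ a ] a ∉ₚ H
  freshParam = fresh λ where
    (rpl A) → map-bound (λ where (rpl p) → p) (param-bound A)
    (sp s)  → 0 , λ ()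

  -- The type of the variables that are introduced for a quantified formula on the given side.
  spvar : Side → ℕ → SPVar
  spvar L = type1
  spvar R = type0

  freshSPVar : ∀ s H → ∃[ k ] spvar s k ∉ₛ H
  freshSPVar L = fresh λ where
    (rpl A)        → 0 , λ ()
    (sp (type0 j)) → 0 , λ ()
    (sp (type1 j)) → suc j , λ where refl → ℕₚ.n<1+n j
  freshSPVar R = fresh λ where
    (rpl A)        → 0 , λ ()
    (sp (type0 j)) → suc j , λ where refl → ℕₚ.n<1+n j
    (sp (type1 j)) → 0 , λ ()

  _≟ₛ_ : DecidableEquality SPVar
  type0 m ≟ₛ type0 n = map′ (cong type0) (λ where refl → refl) (m ℕₚ.≟ n)
  type0 m ≟ₛ type1 n = no λ ()
  type1 m ≟ₛ type0 n = no λ ()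
  type1 m ≟ₛ type1 n = map′ (cong type1) (λ where refl → refl) (m ℕₚ.≟ n)

  -- Members of sequents

  allMembers-resp-≈ : ∀ {P : Formula → Set} {H H′} → H ≈ H′ → AllMembers P H → AllMembers P H′
  allMembers-resp-≈ = ≈ₚ.All-resp-↭ λ (p , q) (ps , qs) → All-resp-↭ p ps , All-resp-↭ q qs

  ¬anyMember⇒allMembers¬ : ∀ {P : Formula → Set} {H} → ¬ AnyMember P H → AllMembers (¬_ ∘ P) H
  ¬anyMember⇒allMembers¬ h = All.map (λ n → All.¬Any⇒All¬ _ (n ∘ inj₁) , All.¬Any⇒All¬ _ (n ∘ inj₂))
                                     (All.¬Any⇒All¬ _ h)

  attach : Side → Formula → Sequent → Sequent
  attach L F (Γ ⇒ Δ) = F ∷ Γ ⇒ Δ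
  attach R F (Γ ⇒ Δ) = Γ ⇒ F ∷ Δ

  pair : Side → Formula → Formula → Sequent
  pair s F G = attach s F (attach (opposite s) G ([] ⇒ []))

  -- The rules for weak quantifiers choose a closed term and introduce a variable; those for strong
  -- quantifiers choose a parameter. Indexing by the side merges each mirror pair of rules into one
  -- argument.
  weak strong : Side → Var → RPL∀ → RPL∀
  weak L   = all
  weak R   = ex
  strong L = ex
  strong R = all

  -- Values of quantifier-free formulas and sequents

  -- δ is the margin by which the sequents of the hypersequent under construction are false.
  record Model : Set₁ where
    field
      interpretation : HsInterpretation
    open HsInterpretation interpretation public
    field
      valuation : Valuation
      δ         : ℚ
      0<δ       : 0ℚ ℚ.< δ
  open Model using (δ; 0<δ)

  Value : Set₁
  Value = Model → ℝ

  spValue : SPVar → Value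
  spValue s e = Model.∣_∣ₐ e (Model.valuation e) (sp s)

  -- The value 0ᵣ of a quantified formula is a dummy.
  truth : RPL∀ → Value
  truth (atom P)  e = Model.∣_∣ₐ e (Model.valuation e) (atom P)
  truth (A ⊃ B)   e = truth A e ⊃ᵣ truth B e
  truth (all x A) e = 0ᵣ
  truth (ex x A)  e = 0ᵣ

  -- A semipropositional variable of a given proof is read as an arbitrary function of the model.
  data Member : Set₁ where
    rpl : RPL∀ → Member
    val : Value → Member

  memberValue : Member → Value
  memberValue (rpl A) = truth A
  memberValue (val v) = v

  emb : Formula → Member
  emb (rpl A) = rpl A
  emb (sp s)  = val (spValue s)

  inst : (Param → Param) → (SPVar → Value) → Formula → Member
  inst σ ρ (rpl A) = rpl (rename σ A)
  inst σ ρ (sp s)  = val (ρ s)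

  Signed : Set₁
  Signed = Side × Member

  signed : (Formula → Member) → Sequent → List Signed
  signed f (Γ ⇒ Δ) = map (λ F → L , f F) Γ ++ map (λ F → R , f F) Δ

  signed-resp-≈ₛ : ∀ f {S T} → S ≈ₛ T → signed f S ↭ signed f T
  signed-resp-≈ₛ f (p , q) = ++⁺ (map⁺ _ p) (map⁺ _ q)

  signed-attach : ∀ f s F S → signed f (attach s F S) ↭ (s , f F) ∷ signed f S
  signed-attach f L F (Γ ⇒ Δ) = refl
  signed-attach f R F (Γ ⇒ Δ) = shift _ (map (λ F → L , f F) Γ) (map (λ F → R , f F) Δ)

  signed-pair : ∀ f s F G → signed f (pair s F G) ↭ (s , f F) ∷ (opposite s , f G) ∷ []
  signed-pair f L F G = refl
  signed-pair f R F G = swap _ _ refl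

  signed-cong : ∀ {P : Formula → Set} {f g} → (∀ {F} → P F → f F ≡ g F) →
                ∀ {S} → All P (proj₁ S) × All P (proj₂ S) → signed f S ≡ signed g S
  signed-cong {P} {f} {g} h (p , q) = cong₂ _++_ (side p) (side q)
    where
    side : ∀ {s Γ} → All P Γ → map (λ F → s , f F) Γ ≡ map (λ F → s , g F) Γ
    side []               = refl
    side {s} (pF ∷ pΓ) = cong₂ _∷_ (cong (s ,_) (h pF)) (side pΓ)

  signed-cong′ : ∀ {f g} → (∀ F → f F ≡ g F) → ∀ S → signed f S ≡ signed g S
  signed-cong′ h S = signed-cong {P = λ _ → ⊤} (λ {F} _ → h F) {S}
    (All.universal (λ _ → tt) (proj₁ S) , All.universal (λ _ → tt) (proj₂ S))

  -- The signs make the total of an atomic sequent its right value minus its left value, so truth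
  -- means a nonnegative total.
  contribution : Model → Signed → ℝ
  contribution e (L , F) = 1ᵣ -ᵣ memberValue F e
  contribution e (R , F) = memberValue F e -ᵣ 1ᵣ

  total : Model → List Signed → ℝ
  total e []      = 0ᵣ
  total e (m ∷ X) = contribution e m +ᵣ total e X

  total-↭ : ∀ e {X Y} → X ↭ Y → ∀ n → seq (total e X) n ≡ seq (total e Y) n
  total-↭ e refl         n = refl
  total-↭ e (prep m p)   n = cong (seq (contribution e m) n ℚ.+_) (total-↭ e p n)
  total-↭ e (swap {ys = Y} m m′ p) n = trans
    (cong (λ t → seq (contribution e m) n ℚ.+ (seq (contribution e m′) n ℚ.+ t)) (total-↭ e p n))
    (solve 3 (λ a b c → a :+ (b :+ c) := b :+ (a :+ c)) refl
      (seq (contribution e m) n) (seq (contribution e m′) n) (seq (total e Y) n))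
  total-↭ e (transitive p q)  n = trans (total-↭ e p n) (total-↭ e q n)

  total-++ : ∀ e X Y n → seq (total e (X ++ Y)) n ≡ seq (total e X) n ℚ.+ seq (total e Y) n
  total-++ e []      Y n = sym (ℚₚ.+-identityˡ (seq (total e Y) n))
  total-++ e (m ∷ X) Y n = trans
    (cong (seq (contribution e m) n ℚ.+_) (total-++ e X Y n))
    (sym (ℚₚ.+-assoc (seq (contribution e m) n) (seq (total e X) n) (seq (total e Y) n)))

  QF : Signed → Set
  QF (s , rpl A) = QuantifierFree A
  QF (s , val v) = ⊤

  -- Margins, falsification and coverage

  -- The exponent counts the (→⇒) steps of D replayed so far on the current branch; each of them
  -- spends half of the remaining margin.
  halves : ℕ → ℚ → ℚ
  halves zero    δ = δ
  halves (suc k) δ = ½ ℚ.* halves k δ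

  halves-pos : ∀ k {δ} → 0ℚ ℚ.< δ → 0ℚ ℚ.< halves k δ
  halves-pos zero    0<δ = 0<δ
  halves-pos (suc k) 0<δ = half-pos (halves-pos k 0<δ)

  halves-suc≤ : ∀ k {δ} → 0ℚ ℚ.< δ → halves (suc k) δ ℚ.≤ halves k δ
  halves-suc≤ k {δ} 0<δ = subst (halves (suc k) δ ℚ.≤_) (half+half (halves k δ))
    (p≤p+q (halves (suc k) δ) (ℚₚ.<⇒≤ (halves-pos (suc k) 0<δ)))

  halves≤ : ∀ k {δ} → 0ℚ ℚ.< δ → halves k δ ℚ.≤ δ
  halves≤ zero    0<δ = ℚₚ.≤-refl
  halves≤ (suc k) 0<δ = ℚₚ.≤-trans (halves-suc≤ k 0<δ) (halves≤ k 0<δ)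

  margin : ℕ → Model → ℝ
  margin k e = fromℚ (halves k (δ e))

  -- A sequent that still contains a quantifier is falsified vacuously. Refuting `Falsified`
  -- therefore speaks about the quantifier-free sequents alone.
  FalsifiedBy : Model → ℚ → Sequent → Set₁
  FalsifiedBy e δ S = All QF (signed emb S) → total e (signed emb S) +ᵣ fromℚ δ ≼ 0ᵣ

  Falsified : Hypersequent → Model → Set₁
  Falsified w e = All (FalsifiedBy e (δ e)) w

  -- Covers w K k X says that, as far as proofs are concerned, the signed sequent X is as good as a
  -- member of w.  If X is quantifier-free, it is false (by the k-th margin) in every model from K in
  -- which w is falsified; if X contains quantifiers, then the rules for them can be simulated in w.
  data Covers (w : Hypersequent) (K : Model → Set) : ℕ → List Signed → Set₁ where
    member  : ∀ {k S X} → S ∈ w → X ↭ signed emb S → Covers w K k X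
    chain   : ∀ {k s F v X Y} → X ↭ (s , F) ∷ Y →
              Covers w K k ((s , val v) ∷ Y) →
              Covers w K k ((s , F) ∷ (opposite s , val v) ∷ []) →
              Covers w K k X
    witness : ∀ {k s x A X Y} b → X ↭ (s , rpl (strong s x A)) ∷ Y →
              Covers w K k ((s , rpl (A [ par b / x ])) ∷ Y) →
              Covers w K k X
    replace : ∀ {j k X Y} Ξ Ξ′ → X ↭ Ξ′ ++ Y → All QF Ξ → All QF Ξ′ →
              (∀ e → K e → total e Ξ′ +ᵣ margin k e ≼ total e Ξ +ᵣ margin j e) →
              Covers w K j (Ξ ++ Y) → Covers w K k X
    false   : ∀ {k X} → All QF X → (∀ e → K e → total e X +ᵣ margin k e ≼ 0ᵣ) → Covers w K k X

  strong-¬quantifierFree : ∀ s {x A} → ¬ QuantifierFree (strong s x A)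
  strong-¬quantifierFree L ()
  strong-¬quantifierFree R ()

  weak-¬quantifierFree : ∀ s {x A} → ¬ QuantifierFree (weak s x A)
  weak-¬quantifierFree L ()
  weak-¬quantifierFree R ()

  contribution-opposite : ∀ e s F n →
    seq (contribution e (s , F)) n ℚ.+ seq (contribution e (opposite s , F)) n ≡ 0ℚ
  contribution-opposite e L F n =
    solve 2 (λ a b → b :+ (:- a) :+ (a :+ (:- b)) := con 0ℚ) refl (seq (memberValue F e) n) 1ℚ
  contribution-opposite e R F n =
    solve 2 (λ a b → a :+ (:- b) :+ (b :+ (:- a)) := con 0ℚ) refl (seq (memberValue F e) n) 1ℚ

  module _ {w : Hypersequent} {K : Model → Set} {e : Model} (e∈K : K e) (falsified : Falsified w e) where
    -- For `chain` the two inequalities are added: the contributions of `v` cancel, and one of the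
    -- two margins is given up. A `witness` cannot cover a quantifier-free sequent, and `replace`
    -- adds its own inequality to that of the sequent it modifies.
    covers-sound : ∀ {k X} → Covers w K k X → All QF X → total e X +ᵣ margin k e ≼ 0ᵣ
    covers-sound {k} (member {S = S} S∈w p) qX = linear
      (All.lookup falsified S∈w (All-resp-↭ p qX) ⊕ fromℚ-mono-≼ (halves≤ k (0<δ e)))
      λ n → trans (cong (λ t → t ℚ.+ halves k (δ e) ℚ.+ (0ℚ ℚ.+ δ e)) (total-↭ e p n))
        (solve 4 (λ t k d z → t :+ k :+ (z :+ d) := t :+ d :+ k :+ z) refl
          (seq (total e (signed emb S)) n) (halves k (δ e)) (δ e) 0ℚ)
    covers-sound {k} (chain {s = s} {F} {v} {Y = Y} p c d) qX with All-resp-↭ p qX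
    ... | qF ∷ qY = linear
      (covers-sound c (tt ∷ qY) ⊕ covers-sound d (qF ∷ tt ∷ []) ⊕
        fromℚ-mono-≼ (ℚₚ.<⇒≤ (halves-pos k (0<δ e))))
      λ n → let v₁ = seq (contribution e (s , val v)) n
                v₂ = seq (contribution e (opposite s , val v)) n
                f  = seq (contribution e (s , F)) n
                y  = seq (total e Y) n
                m  = halves k (δ e)
        in trans (cong (λ t → t ℚ.+ m ℚ.+ (0ℚ ℚ.+ 0ℚ ℚ.+ m)) (total-↭ e p n)) (
           trans (solve 3 (λ f y m → f :+ y :+ m :+ (con 0ℚ :+ con 0ℚ :+ m) :=
                                     con 0ℚ :+ (f :+ y :+ m :+ m)) refl f y m) (
           trans (cong (ℚ._+ (f ℚ.+ y ℚ.+ m ℚ.+ m)) (sym (contribution-opposite e s (val v) n)))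
                 (solve 5 (λ v₁ v₂ f y m → v₁ :+ v₂ :+ (f :+ y :+ m :+ m) :=
                    v₁ :+ y :+ m :+ (f :+ (v₂ :+ con 0ℚ) :+ m) :+ con 0ℚ :+ con 0ℚ) refl v₁ v₂ f y m)))
    covers-sound (witness {s = s} _ p c) qX with All-resp-↭ p qX
    ... | q ∷ _ = ⊥-elim (strong-¬quantifierFree s q)
    covers-sound {k} (replace {j} {Y = Y} Ξ Ξ′ p qΞ _ h c) qX = linear
      (h e e∈K ⊕ covers-sound c (All.++⁺ qΞ (All.++⁻ʳ Ξ′ (All-resp-↭ p qX))))
      λ n → let x = seq (total e Ξ) n; x′ = seq (total e Ξ′) n; y = seq (total e Y) n
                mⱼ = halves j (δ e); mₖ = halves k (δ e)
        in trans (cong (λ t → t ℚ.+ mₖ ℚ.+ (x ℚ.+ mⱼ ℚ.+ 0ℚ)) (trans (total-↭ e p n) (total-++ e Ξ′ Y n))) (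
           trans (solve 5 (λ x x′ y mⱼ mₖ → x′ :+ y :+ mₖ :+ (x :+ mⱼ :+ con 0ℚ) :=
                             x′ :+ mₖ :+ (x :+ y :+ mⱼ) :+ con 0ℚ) refl x x′ y mⱼ mₖ)
           (cong (λ t → x′ ℚ.+ mₖ ℚ.+ (t ℚ.+ mⱼ) ℚ.+ 0ℚ) (sym (total-++ e Ξ Y n))))
    covers-sound (false _ h) _ = h e e∈K

  module _ {w : Hypersequent} {K : Model → Set} where
    covers-resp-↭ : ∀ {k X Y} → X ↭ Y → Covers w K k Y → Covers w K k X
    covers-resp-↭ q (member S∈w p)     = member S∈w (↭-trans q p)
    covers-resp-↭ q (chain p c d)      = chain (↭-trans q p) c d
    covers-resp-↭ q (witness b p c)    = witness b (↭-trans q p) c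
    covers-resp-↭ q (replace Ξ Ξ′ p qΞ qΞ′ h c) = replace Ξ Ξ′ (↭-trans q p) qΞ qΞ′ h c
    covers-resp-↭ q (false {k} {X} qX h) = false (All-resp-↭ (↭-sym q) qX) λ e e∈K → linear (h e e∈K)
      λ n → trans (cong (λ t → t ℚ.+ halves k (δ e) ℚ.+ 0ℚ) (total-↭ e q n)) refl

    covers-suc : ∀ {k X} → Covers w K k X → Covers w K (suc k) X
    covers-suc {k} c = replace [] [] refl [] []
      (λ e _ → ≼-refl 0ᵣ ⊕ fromℚ-mono-≼ (halves-suc≤ k (0<δ e))) c

  -- Extensions of hypersequents by applications of quantifier rules

  -- All models and all margins are included, so that coverage recorded under any class `K` and any
  -- `k` can be carried over.
  Extends : Hypersequent → Hypersequent → Set₁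
  Extends w w′ = ∀ {S} → S ∈ w → ∀ k → Covers w′ (λ _ → ⊤) k (signed emb S)

  weaken-model : ∀ {w K k X} → Covers w (λ _ → ⊤) k X → Covers w K k X
  weaken-model (member S∈w p)  = member S∈w p
  weaken-model (chain p c d)   = chain p (weaken-model c) (weaken-model d)
  weaken-model (witness b p c) = witness b p (weaken-model c)
  weaken-model (replace Ξ Ξ′ p qΞ qΞ′ h c) = replace Ξ Ξ′ p qΞ qΞ′ (λ e _ → h e tt) (weaken-model c)
  weaken-model (false qX h)    = false qX (λ e _ → h e tt)

  -- Only `member` refers to the hypersequent and only `replace` and `false` refer to the class of
  -- models, so it is enough to substitute at these leaves and weaken these inequalities.
  restrict : ∀ {w w′ K K′ k X} → Extends w w′ → (∀ {e} → K′ e → K e) → Covers w K k X → Covers w′ K′ k X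
  restrict ext sub (member S∈w p)  = covers-resp-↭ p (weaken-model (ext S∈w _))
  restrict ext sub (chain p c d)   = chain p (restrict ext sub c) (restrict ext sub d)
  restrict ext sub (witness b p c) = witness b p (restrict ext sub c)
  restrict ext sub (replace Ξ Ξ′ p qΞ qΞ′ h c) =
    replace Ξ Ξ′ p qΞ qΞ′ (λ e e∈K′ → h e (sub e∈K′)) (restrict ext sub c)
  restrict ext sub (false qX h)    = false qX (λ e e∈K′ → h e (sub e∈K′))

  extends-refl : ∀ {w} → Extends w w
  extends-refl S∈w k = member S∈w refl

  extends-trans : ∀ {w w′ w″} → Extends w w′ → Extends w′ w″ → Extends w w″
  extends-trans ext ext′ S∈w k = restrict ext′ id (ext S∈w k)

  falsified-extends : ∀ {w w′ e} → Extends w w′ → Falsified w′ e → Falsified w e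
  falsified-extends ext falsified = All.tabulate λ S∈w → covers-sound tt falsified (ext S∈w 0)

  MidProof : Hypersequent → ℕ → Set₁
  MidProof w n = Σ[ D ∈ ⊢ w ] (Mid D × Q D ℕ.≤ n)

  -- Quantifier rules, at most n of them, lead upwards from w to w′.
  record Reaches (n : ℕ) (w w′ : Hypersequent) : Set₁ where
    field
      extends : Extends w w′
      lower   : ∀ {m} → MidProof w′ m → MidProof w (n ℕ.+ m)
  open Reaches

  reaches-refl : ∀ {w} → Reaches 0 w w
  reaches-refl .extends = extends-refl
  reaches-refl .lower   = id

  reaches-trans : ∀ {m n w w′ w″} → Reaches m w w′ → Reaches n w′ w″ → Reaches (m ℕ.+ n) w w″
  reaches-trans r r′ .extends = extends-trans (r .extends) (r′ .extends)
  reaches-trans {m} {n} {w} r r′ .lower {o} D =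
    subst (MidProof w) (sym (ℕₚ.+-assoc m n o)) (r .lower (r′ .lower D))

  reaches-mono : ∀ {m n w w′} → m ℕ.≤ n → Reaches m w w′ → Reaches n w w′
  reaches-mono m≤n r .extends = r .extends
  reaches-mono m≤n r .lower D with r .lower D
  ... | D′ , mid , le = D′ , mid , ℕₚ.≤-trans le (ℕₚ.+-monoˡ-≤ _ m≤n)

  open Reaches

  -- Simulation of the quantifier rules

  split-attach : ∀ {s A S Y} → signed emb S ↭ (s , rpl A) ∷ Y →
                 ∃[ T ] (S ≈ₛ attach s (rpl A) T × Y ↭ signed emb T)
  split-attach {s} {A} {Γ ⇒ Δ} {Y} p = [ left , right ]′
    (∈-++⁻ (map (λ F → L , emb F) Γ) (∈-resp-↭ (↭-sym p) (here refl)))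
    where
    rest : ∀ T → (Γ ⇒ Δ) ≈ₛ attach s (rpl A) T → Y ↭ signed emb T
    rest T q = drop-∷ (↭-trans (↭-sym p) (↭-trans (signed-resp-≈ₛ emb q) (signed-attach emb s (rpl A) T)))
    Result = ∃[ T ] ((Γ ⇒ Δ) ≈ₛ attach s (rpl A) T × Y ↭ signed emb T)
    left : (s , rpl A) ∈ map (λ F → L , emb F) Γ → Result
    left m with ∈-map⁻ (λ F → L , emb F) m
    ... | rpl A , A∈Γ , refl with ∈⇒↭ A∈Γ
    ...   | Γ′ , q = (Γ′ ⇒ Δ) , (q , refl) , rest (Γ′ ⇒ Δ) (q , refl)
    right : (s , rpl A) ∈ map (λ F → R , emb F) Δ → Result
    right m with ∈-map⁻ (λ F → R , emb F) m
    ... | rpl A , A∈Δ , refl with ∈⇒↭ A∈Δ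
    ...   | Δ′ , q = (Γ ⇒ Δ′) , (refl , q) , rest (Γ ⇒ Δ′) (refl , q)

  focus : ∀ {w S S′} → S ∈ w → S ≈ₛ S′ →
          ∃[ 𝒢 ] (w ≈ S′ ∷ 𝒢 × (∀ {T} → T ∈ w → T ≡ S ⊎ T ∈ 𝒢))
  focus S∈w S≈S′ with ∈-∃++ S∈w
  ... | as , bs , refl = as ++ bs , ≈ₚ.shift S≈S′ as bs , λ T∈w → cases (∈-resp-↭ (shift _ as bs) T∈w)
    where
    cases : ∀ {T S} → T ∈ S ∷ (as ++ bs) → T ≡ S ⊎ T ∈ as ++ bs
    cases (here eq)  = inj₁ eq
    cases (there T∈) = inj₂ T∈

  weak-rule : ∀ s {H 𝒢 S x A m} k {t} → Closed t → H ≈ attach s (rpl (weak s x A)) S ∷ 𝒢 → spvar s k ∉ₛ H →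
              MidProof (attach s (sp (spvar s k)) S ∷ pair s (rpl (weak s x A)) (sp (spvar s k)) ∷
                        pair s (rpl (A [ t / x ])) (sp (spvar s k)) ∷ 𝒢) m →
              MidProof H (suc m)
  weak-rule L k c eq f (D , mid , le) = ∀⇒ k c eq f D , mid , s≤s le
  weak-rule R k c eq f (D , mid , le) = ⇒∃ k c eq f D , mid , s≤s le

  strong-rule : ∀ s {H 𝒢 S x A m} a → H ≈ attach s (rpl (strong s x A)) S ∷ 𝒢 → a ∉ₚ H →
                MidProof (attach s (rpl (A [ par a / x ])) S ∷ 𝒢) m → MidProof H (suc m)
  strong-rule L a eq f (D , mid , le) = ∃⇒ a eq f D , mid , s≤s le
  strong-rule R a eq f (D , mid , le) = ⇒∀ a eq f D , mid , s≤s le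

  Allowed : Side → Value → Set₁
  Allowed L v = ∀ e → v e ≤ᵣ 1ᵣ
  Allowed R v = ∀ e → 0ᵣ ≤ᵣ v e

  spValue-allowed : ∀ s k → Allowed s (spValue (spvar s k))
  spValue-allowed L k e = proj₂ (Model.⟦sp1⟧ e k)
  spValue-allowed R k e = proj₂ (Model.⟦sp0⟧ e k)

  record Updated (w : Hypersequent) (K : Model → Set) (k : ℕ) (s : Side) (Y : List Signed)
                 (Good : Hypersequent → Member → Set₁) : Set₁ where
    field
      {target} : Hypersequent
      {new}    : Member
      reaches  : Reaches 1 w target
      good     : Good target new
      covered  : Covers target K k ((s , new) ∷ Y)

  -- A quantified member of a covered sequent is either copied from a member of w or an instance of
  -- it was recorded by witness.
  module Update (w : Hypersequent) (K : Model → Set) (s : Side) {A : RPL∀} (¬qA : ¬ QuantifierFree A)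
                (Good : Hypersequent → Member → Set₁)
                (at-member  : ∀ {k S Y} → S ∈ w → signed emb S ↭ (s , rpl A) ∷ Y → Updated w K k s Y Good)
                (at-witness : ∀ {k Y x B} b → A ≡ strong s x B →
                              Covers w K k ((s , rpl (B [ par b / x ])) ∷ Y) → Updated w K k s Y Good) where
    open Updated

    update-covered : ∀ {k X Y} → Covers w K k X → X ↭ (s , rpl A) ∷ Y → Updated w K k s Y Good
    update-covered (member S∈w p) q = at-member S∈w (↭-trans (↭-sym p) q)
    update-covered (chain p c d) q with ∷-↭-∷ (↭-trans (↭-sym p) q)
    -- The formula sought is the one already exchanged for `v`. A copy of it survives in the sequent
    -- with `v` on the opposite side, and the rule is directed there.
    ... | inj₁ (refl , r) = let u = update-covered d refl in record
      { reaches = u .reaches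
      ; good    = u .good
      ; covered = chain (prep _ (↭-sym r)) (restrict (u .reaches .extends) id c) (u .covered)
      }
    ... | inj₂ (Z , r , r′) = let u = update-covered c (↭-trans (prep _ r) (swap _ _ refl)) in record
      { reaches = u .reaches
      ; good    = u .good
      ; covered = chain (↭-trans (prep _ r′) (swap _ _ refl)) (covers-resp-↭ (swap _ _ refl) (u .covered))
                    (restrict (u .reaches .extends) id d)
      }
    update-covered (witness b p c) q with ∷-↭-∷ (↭-trans (↭-sym p) q)
    ... | inj₁ (refl , r) = at-witness b refl (covers-resp-↭ (prep _ (↭-sym r)) c)
    ... | inj₂ (Z , r , r′) = let u = update-covered c (↭-trans (prep _ r) (swap _ _ refl)) in record
      { reaches = u .reaches
      ; good    = u .good
      ; covered = witness b (↭-trans (prep _ r′) (swap _ _ refl)) (covers-resp-↭ (swap _ _ refl) (u .covered))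
      }
    update-covered (replace {Y = Z} Ξ Ξ′ p qΞ qΞ′ h c) q
      with ∈-++⁻ Ξ′ (∈-resp-↭ (↭-trans (↭-sym q) p) (here refl))
    ... | inj₁ A∈Ξ′ = ⊥-elim (¬qA (All.lookup qΞ′ A∈Ξ′))
    ... | inj₂ A∈Z with ∈⇒↭ A∈Z
    ...   | Z′ , r =
      let u = update-covered c (↭-trans (++⁺ˡ Ξ r) (shift _ Ξ Z′)) in record
      { reaches = u .reaches
      ; good    = u .good
      ; covered = replace Ξ Ξ′
          (↭-trans (prep _ (drop-∷ (↭-trans (↭-sym q) (↭-trans p (↭-trans (++⁺ˡ Ξ′ r) (shift _ Ξ′ Z′))))))
                   (↭-sym (shift _ Ξ′ Z′)))
          qΞ qΞ′ h (covers-resp-↭ (shift _ Ξ Z′) (u .covered))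
      }
    update-covered (false qX h) q with All-resp-↭ q qX
    ... | qA ∷ _ = ⊥-elim (¬qA qA)

  WeakGood : (K : Model → Set) (s : Side) (x : Var) (A : RPL∀) (t : Term) → Hypersequent → Member → Set₁
  WeakGood K s x A t w F = ∃[ v ] (F ≡ val v × Allowed s v ×
    (∀ k → Covers w K k ((s , rpl (weak s x A)) ∷ (opposite s , F) ∷ [])) ×
    (∀ k → Covers w K k ((s , rpl (A [ t / x ])) ∷ (opposite s , F) ∷ [])))

  weak≢strong : ∀ s {x y A B} → weak s x A ≢ strong s y B
  weak≢strong L ()
  weak≢strong R ()

  weak-update : ∀ {w K k X Y} s {x A t} → Closed t → Covers w K k X → X ↭ (s , rpl (weak s x A)) ∷ Y →
                Updated w K k s Y (WeakGood K s x A t)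
  weak-update {w} {K} s {x} {A} {t} closed = Update.update-covered w K s (weak-¬quantifierFree s)
    (WeakGood K s x A t) at-member (λ _ eq _ → ⊥-elim (weak≢strong s eq))
    where
    at-member : ∀ {k S Y} → S ∈ w → signed emb S ↭ (s , rpl (weak s x A)) ∷ Y →
                Updated w K k s Y (WeakGood K s x A t)
    at-member S∈w p with split-attach p | freshSPVar s w
    ... | T , S≈ , Y↭ | n , n∉ with focus S∈w S≈
    ...   | 𝒢 , w≈ , split = record
      { target  = w′
      ; reaches = record { extends = ext ; lower = weak-rule s n closed w≈ n∉ }
      ; good    = v , refl , spValue-allowed s n , quantified , instantiated
      ; covered = covers-resp-↭ (prep _ Y↭) main
      }
      where
      q = sp (spvar s n)
      v = spValue (spvar s n)
      w′ = attach s q T ∷ pair s (rpl (weak s x A)) q ∷ pair s (rpl (A [ t / x ])) q ∷ 𝒢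
      main : ∀ {K k} → Covers w′ K k ((s , val v) ∷ signed emb T)
      main = member (here refl) (↭-sym (signed-attach emb s q T))
      quantified : ∀ {K} k → Covers w′ K k ((s , rpl (weak s x A)) ∷ (opposite s , val v) ∷ [])
      quantified k = member (there (here refl)) (↭-sym (signed-pair emb s (rpl (weak s x A)) q))
      instantiated : ∀ {K} k → Covers w′ K k ((s , rpl (A [ t / x ])) ∷ (opposite s , val v) ∷ [])
      instantiated k = member (there (there (here refl))) (↭-sym (signed-pair emb s (rpl (A [ t / x ])) q))
      ext : Extends w w′
      ext U∈w k with split U∈w
      -- The consumed sequent is recovered from the first two premise sequents by cancelling the new
      -- variable.
      ... | inj₁ refl = chain p (covers-resp-↭ (prep _ Y↭) main) (quantified k)
      ... | inj₂ U∈𝒢  = member (there (there (there U∈𝒢))) refl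

  StrongGood : Var → RPL∀ → Hypersequent → Member → Set₁
  StrongGood x A w F = ∃[ b ] F ≡ rpl (A [ par b / x ])

  strong-injective : ∀ s {x y A B} → strong s x A ≡ strong s y B → x ≡ y × A ≡ B
  strong-injective L refl = refl , refl
  strong-injective R refl = refl , refl

  strong-update : ∀ {w K k X Y} s {x A} → Covers w K k X → X ↭ (s , rpl (strong s x A)) ∷ Y →
                  Updated w K k s Y (StrongGood x A)
  strong-update {w} {K} s {x} {A} = Update.update-covered w K s (strong-¬quantifierFree s)
    (StrongGood x A) at-member at-witness
    where
    at-member : ∀ {k S Y} → S ∈ w → signed emb S ↭ (s , rpl (strong s x A)) ∷ Y →
                Updated w K k s Y (StrongGood x A)
    at-member S∈w p with split-attach p | freshParam w
    ... | T , S≈ , Y↭ | b , b∉ with focus S∈w S≈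
    ...   | 𝒢 , w≈ , split = record
      { target  = w′
      ; reaches = record { extends = ext ; lower = strong-rule s b w≈ b∉ }
      ; good    = b , refl
      ; covered = covers-resp-↭ (prep _ Y↭) main
      }
      where
      w′ = attach s (rpl (A [ par b / x ])) T ∷ 𝒢
      main : ∀ {K k} → Covers w′ K k ((s , rpl (A [ par b / x ])) ∷ signed emb T)
      main = member (here refl) (↭-sym (signed-attach emb s (rpl (A [ par b / x ])) T))
      ext : Extends w w′
      ext U∈w k with split U∈w
      -- No copy of the strong formula remains, so the consumed sequent is remembered together with
      -- the parameter chosen for it.
      ... | inj₁ refl = witness b p (covers-resp-↭ (prep _ Y↭) main)
      ... | inj₂ U∈𝒢  = member (there U∈𝒢) refl
    at-witness : ∀ {k Y y B} b → strong s x A ≡ strong s y B →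
                 Covers w K k ((s , rpl (B [ par b / y ])) ∷ Y) → Updated w K k s Y (StrongGood x A)
    at-witness b eq c with strong-injective s eq
    -- The earlier instance is reused: no rule is applied to `w`, and the allowance of one is left
    -- unspent.
    ... | refl , refl = record { reaches = reaches-mono z≤n reaches-refl ; good = b , refl ; covered = c }

  -- Completeness of the propositional rules

  True : Model → Sequent → Set₁
  True e S = All QF (signed emb S) × 0ᵣ ≼ total e (signed emb S)

  Valid : Hypersequent → Set₁
  Valid w = ∀ e → ¬ ¬ Any (True e) w

  Refutes : (Model → Set) → Hypersequent → Set₁
  Refutes K w = ∀ e → K e → ¬ Falsified w e

  total-≼ : ∀ e {X Y} → X ↭ Y → total e X ≼ total e Y
  total-≼ e p = pointwise⇒≼ λ n → ℚₚ.≤-reflexive (total-↭ e p n)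

  true-resp-≈ₛ : ∀ {e S T} → S ≈ₛ T → True e S → True e T
  true-resp-≈ₛ {e} {S} {T} p (qS , h) =
    All-resp-↭ q qS , ≼-trans h (total-≼ e q)
    where q = signed-resp-≈ₛ emb {S} {T} p

  withMargin : (e : Model) (δ : ℚ) → 0ℚ ℚ.< δ → Model
  withMargin e δ 0<δ = record
    { interpretation = Model.interpretation e ; valuation = Model.valuation e ; δ = δ ; 0<δ = 0<δ }

  module _ (e : Model) (δ : ℚ) (0<δ : 0ℚ ℚ.< δ) where
    private e′ = withMargin e δ 0<δ

    truth-withMargin : ∀ A → truth A e′ ≡ truth A e
    truth-withMargin (atom P)  = refl
    truth-withMargin (A ⊃ B)   = cong₂ _⊃ᵣ_ {truth A e′} {truth A e} {truth B e′} {truth B e}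
      (truth-withMargin A) (truth-withMargin B)
    truth-withMargin (all x A) = refl
    truth-withMargin (ex x A)  = refl

    emb-withMargin : ∀ F → memberValue (emb F) e′ ≡ memberValue (emb F) e
    emb-withMargin (rpl A) = truth-withMargin A
    emb-withMargin (sp s)  = refl

    total-withMargin : ∀ S → total e′ (signed emb S) ≡ total e (signed emb S)
    total-withMargin (Γ ⇒ Δ) = left Γ
      where
      right : ∀ Δ → total e′ (map (λ F → R , emb F) Δ) ≡ total e (map (λ F → R , emb F) Δ)
      right []      = refl
      right (F ∷ Δ) = cong₂ (λ x y → x -ᵣ 1ᵣ +ᵣ y) (emb-withMargin F) (right Δ)
      left : ∀ Γ → total e′ (signed emb (Γ ⇒ Δ)) ≡ total e (signed emb (Γ ⇒ Δ))
      left []      = right Δ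
      left (F ∷ Γ) = cong₂ (λ x y → 1ᵣ -ᵣ x +ᵣ y) (emb-withMargin F) (left Γ)

  falsifiedBy-shrink : ∀ e {δ δ′} S → δ ℚ.≤ δ′ → FalsifiedBy e δ′ S → FalsifiedBy e δ S
  falsifiedBy-shrink e {δ} {δ′} S δ≤δ′ h qS =
    ≼-trans {y = total e (signed emb S) +ᵣ fromℚ δ′}
      (≼-refl (total e (signed emb S)) ⊕ fromℚ-mono-≼ δ≤δ′) (h qS)

  -- The hypersequent is finite, so the minimum of the gaps of its sequents serves all of them.
  ¬true⇒falsified : ∀ e w → ¬ Any (True e) w → ¬ ¬ (∃[ δ ] (0ℚ ℚ.< δ × All (FalsifiedBy e δ) w))
  ¬true⇒falsified e []      n k = k (1ℚ , ℚₚ.positive⁻¹ 1ℚ , [])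
  ¬true⇒falsified e (S ∷ w) n k = ¬true⇒falsified e w (n ∘ there) λ (δ , 0<δ , falsified) →
    ≼-or-gap 0ᵣ (total e (signed emb S)) λ where
      -- A nonnegative total without truth means that a quantifier occurs, and then falsification is
      -- vacuous.
      (inj₁ h) → k (δ , 0<δ , (λ qS → ⊥-elim (n (here (qS , h)))) ∷ falsified)
      (inj₂ (δ′ , 0<δ′ , gap)) → k (δ ℚ.⊓ δ′ , ⊓-pos 0<δ 0<δ′ ,
        falsifiedBy-shrink e S (ℚₚ.p⊓q≤q δ δ′) (λ _ → gap) ∷
        All.map (λ {T} → falsifiedBy-shrink e T (ℚₚ.p⊓q≤p δ δ′)) falsified)

  falsifiedBy-withMargin : ∀ e {δ} (0<δ : 0ℚ ℚ.< δ) S →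
                           FalsifiedBy e δ S → FalsifiedBy (withMargin e δ 0<δ) δ S
  falsifiedBy-withMargin e {δ} 0<δ S h qS = subst (λ t → t +ᵣ fromℚ δ ≼ 0ᵣ)
    {total e (signed emb S)} {total (withMargin e δ 0<δ) (signed emb S)}
    (sym (total-withMargin e δ 0<δ S)) (h qS)

  -- The margin is found only after the interpretation is fixed. Since `Refutes` covers every
  -- positive margin and values of `emb` do not depend on it, the model may be given exactly this
  -- one.
  refutes⇒valid : ∀ {w} → Refutes (λ _ → ⊤) w → Valid w
  refutes⇒valid {w} refutes e n = ¬true⇒falsified e w n λ (δ , 0<δ , falsified) →
    refutes (withMargin e δ 0<δ) tt (All.map (λ {S} → falsifiedBy-withMargin e 0<δ S) falsified)

  valid-resp-≈ : ∀ {w w′} → w ≈ w′ → Valid w → Valid w′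
  valid-resp-≈ p valid e n = valid e (n ∘ ≈ₚ.Any-resp-↭ (λ {S} {T} → true-resp-≈ₛ {e} {S} {T}) p)

  -- If the variable is at most A ⊃ B, putting it in place of A ⊃ B on the left can only raise the
  -- total. If it is at least A ⊃ B, either A ⊃ B is 1 and the type 1 bound leads back to the first
  -- case, or it is 1 - A + B and the second premise sequent is true.
  valid-⊃ˡ : ∀ {Γ Δ A B 𝒢} k → Valid ((rpl (A ⊃ B) ∷ Γ ⇒ Δ) ∷ 𝒢) →
             Valid ((sp (type1 k) ∷ Γ ⇒ Δ) ∷ (rpl B ∷ [] ⇒ sp (type1 k) ∷ rpl A ∷ []) ∷ 𝒢)
  valid-⊃ˡ {Γ} {Δ} {A} {B} {𝒢} k valid e n = valid e principal
    where
    p i : ℝ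
    p = spValue (type1 k) e
    i = truth A e ⊃ᵣ truth B e
    principal : Any (True e) ((rpl (A ⊃ B) ∷ Γ ⇒ Δ) ∷ 𝒢) → ⊥
    principal (there h)                  = n (there (there h))
    principal (here ((qA ⊃ qB) ∷ qS , h)) = ≼-total p i λ where
        (inj₁ p≼i) → first p≼i
        (inj₂ i≼p) → ⊃ᵣ-cases (truth A e) (truth B e) λ where
          (inj₁ 1≼i) → first (≼-trans (≼-intro (spValue-allowed L k e)) 1≼i)
          (inj₂ z≼i) → n (there (here (qB ∷ tt ∷ qA ∷ [] ,
            residual (truth A e) (truth B e) p (λ _ → refl) (≼-trans z≼i i≼p))))
      where
      first : p ≼ i → ⊥
      first p≼i = n (here (tt ∷ qS ,
        left-mono i p (total e (signed emb (Γ ⇒ Δ))) (λ _ → refl) (λ _ → refl) h p≼i))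

  module _ {Γ Δ : List Formula} {A B : RPL∀} where
    private
      perm : signed emb (Γ ⇒ rpl (A ⊃ B) ∷ Δ) ↭ (R , rpl (A ⊃ B)) ∷ signed emb (Γ ⇒ Δ)
      perm = signed-attach emb R (rpl (A ⊃ B)) (Γ ⇒ Δ)

      perm′ : (L , rpl A) ∷ (R , rpl B) ∷ signed emb (Γ ⇒ Δ) ↭ signed emb (rpl A ∷ Γ ⇒ rpl B ∷ Δ)
      perm′ = prep _ (↭-sym (signed-attach emb R (rpl B) (Γ ⇒ Δ)))

      members : All QF (signed emb (Γ ⇒ rpl (A ⊃ B) ∷ Δ)) →
                QuantifierFree A × QuantifierFree B × All QF (signed emb (Γ ⇒ Δ))
      members qS with All-resp-↭ perm qS
      ... | (qA ⊃ qB) ∷ q = qA , qB , q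

      true₁ : ∀ e → True e (Γ ⇒ rpl (A ⊃ B) ∷ Δ) → True e (Γ ⇒ Δ)
      true₁ e (qS , h) = proj₂ (proj₂ (members qS)) ,
        right-drop (truth (A ⊃ B) e) (total e (signed emb (Γ ⇒ Δ))) (total-↭ e perm) h
          (⊃ᵣ≼1 (truth A e) (truth B e))

      true₂ : ∀ e → True e (Γ ⇒ rpl (A ⊃ B) ∷ Δ) → True e (rpl A ∷ Γ ⇒ rpl B ∷ Δ)
      true₂ e (qS , h) =
        All-resp-↭ perm′ (proj₁ (members qS) ∷ proj₁ (proj₂ (members qS)) ∷ proj₂ (proj₂ (members qS))) ,
        right-split (truth A e) (truth B e) (total e (signed emb (Γ ⇒ Δ))) (total-↭ e perm)
          (λ n → sym (total-↭ e perm′ n)) h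

    valid-⊃ʳ₁ : ∀ {𝒢} → Valid ((Γ ⇒ rpl (A ⊃ B) ∷ Δ) ∷ 𝒢) → Valid ((Γ ⇒ Δ) ∷ 𝒢)
    valid-⊃ʳ₁ valid e n = valid e λ where
      (there h) → n (there h)
      (here t)  → n (here (true₁ e t))

    valid-⊃ʳ₂ : ∀ {𝒢} → Valid ((Γ ⇒ rpl (A ⊃ B) ∷ Δ) ∷ 𝒢) → Valid ((rpl A ∷ Γ ⇒ rpl B ∷ Δ) ∷ 𝒢)
    valid-⊃ʳ₂ valid e n = valid e λ where
      (there h) → n (there h)
      (here t)  → n (here (true₂ e t))

  IsImplication : Formula → Set
  IsImplication F = ∃[ A ] ∃[ B ] F ≡ rpl (A ⊃ B)

  isImplication? : ∀ F → Dec (IsImplication F)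
  isImplication? (rpl (atom P))  = no λ ()
  isImplication? (rpl (A ⊃ B))   = yes (A , B , refl)
  isImplication? (rpl (all x A)) = no λ ()
  isImplication? (rpl (ex x A))  = no λ ()
  isImplication? (sp s)          = no λ ()

  size : RPL∀ → ℕ
  size (A ⊃ B) = suc (size A ℕ.+ size B)
  size _       = 0

  formulaWeight : Formula → ℕ
  formulaWeight (rpl A) = size A
  formulaWeight (sp s)  = 0

  sequentWeight : Sequent → ℕ
  sequentWeight (Γ ⇒ Δ) = sum (map formulaWeight Γ) ℕ.+ sum (map formulaWeight Δ)

  weight : Hypersequent → ℕ
  weight w = sum (map sequentWeight w)

  sequentWeight-resp : ∀ {S T} → S ≈ₛ T → sequentWeight S ≡ sequentWeight T
  sequentWeight-resp (p , q) = cong₂ ℕ._+_ (sum-↭ (map⁺ formulaWeight p)) (sum-↭ (map⁺ formulaWeight q))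

  weight-resp : ∀ {w w′} → w ≈ w′ → weight w ≡ weight w′
  weight-resp (≈ₛ.refl p) = pointwise p
    where
    pointwise : ∀ {w w′} → Pointwise _≈ₛ_ w w′ → weight w ≡ weight w′
    pointwise []       = refl
    pointwise (p ∷ ps) = cong₂ ℕ._+_ (sequentWeight-resp p) (pointwise ps)
  weight-resp (≈ₛ.prep p ps) = cong₂ ℕ._+_ (sequentWeight-resp p) (weight-resp ps)
  weight-resp (≈ₛ.swap {ys = w} {x′ = S} {y′ = T} p q ps) = trans
    (cong₂ ℕ._+_ (sequentWeight-resp p) (cong₂ ℕ._+_ (sequentWeight-resp q) (weight-resp ps)))
    (solveℕ 3 (λ s t w → s :+ℕ (t :+ℕ w) :=ℕ t :+ℕ (s :+ℕ w)) refl
      (sequentWeight S) (sequentWeight T) (weight w))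
  weight-resp (≈ₛ.trans p q) = trans (weight-resp p) (weight-resp q)

  module _ (A B : RPL∀) (Γ Δ : List Formula) (𝒢 : Hypersequent) where
    private
      a = size A
      b = size B
      g = sum (map formulaWeight Γ)
      d = sum (map formulaWeight Δ)
      h = weight 𝒢

    -- The variable has weight 0 and A and B each appear once in the premise, so exactly one
    -- implication disappears.
    weight-⊃ˡ : ∀ k → weight ((sp (type1 k) ∷ Γ ⇒ Δ) ∷ (rpl B ∷ [] ⇒ sp (type1 k) ∷ rpl A ∷ []) ∷ 𝒢) ℕ.<
                      weight ((rpl (A ⊃ B) ∷ Γ ⇒ Δ) ∷ 𝒢)
    weight-⊃ˡ k = ℕₚ.≤-reflexive (solveℕ 5 (λ a b g d h →
      conℕ 1 :+ℕ (g :+ℕ d :+ℕ (b :+ℕ conℕ 0 :+ℕ (a :+ℕ conℕ 0) :+ℕ h)) :=ℕ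
      conℕ 1 :+ℕ (a :+ℕ b) :+ℕ g :+ℕ d :+ℕ h) refl a b g d h)

    weight-⊃ʳ₁ : weight ((Γ ⇒ Δ) ∷ 𝒢) ℕ.< weight ((Γ ⇒ rpl (A ⊃ B) ∷ Δ) ∷ 𝒢)
    weight-⊃ʳ₁ = subst (suc (g ℕ.+ d ℕ.+ h) ℕ.≤_) (solveℕ 5 (λ a b g d h →
      conℕ 1 :+ℕ (g :+ℕ d :+ℕ h) :+ℕ (a :+ℕ b) :=ℕ g :+ℕ (conℕ 1 :+ℕ (a :+ℕ b) :+ℕ d) :+ℕ h) refl a b g d h)
      (ℕₚ.m≤m+n (suc (g ℕ.+ d ℕ.+ h)) (a ℕ.+ b))

    weight-⊃ʳ₂ : weight ((rpl A ∷ Γ ⇒ rpl B ∷ Δ) ∷ 𝒢) ℕ.< weight ((Γ ⇒ rpl (A ⊃ B) ∷ Δ) ∷ 𝒢)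
    weight-⊃ʳ₂ = ℕₚ.≤-reflexive (solveℕ 5 (λ a b g d h →
      conℕ 1 :+ℕ (a :+ℕ g :+ℕ (b :+ℕ d) :+ℕ h) :=ℕ g :+ℕ (conℕ 1 :+ℕ (a :+ℕ b) :+ℕ d) :+ℕ h) refl a b g d h)

  module _ (M : HsInterpretation) (ν : HsInterpretation.Valuation M) (e : Model) (f : Formula → Member)
           (f-value : ∀ {F} (a : IsAtom F) → memberValue (f F) e ≡ HsInterpretation.∣_∣ₐ M ν a) where
    open HsInterpretation M using (∣_∣ₐ; ∣_∣ₘ)

    -- Stated for a general `f` because it is read in two directions: with `emb` to turn a true
    -- sequent into an axiom, and with `inst` to use an axiom of D.
    total-atomic : ∀ {Γ Δ} (γ : All IsAtom Γ) (δ : All IsAtom Δ) n →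
      seq (total e (signed f (Γ ⇒ Δ))) n ≡ seq (∣_∣ₘ ν δ -ᵣ ∣_∣ₘ ν γ) n
    total-atomic [] δ n = trans (right δ) (sym (ℚₚ.+-identityʳ (seq (∣_∣ₘ ν δ) n)))
      where
      right : ∀ {Δ} (δ : All IsAtom Δ) → seq (total e (map (λ F → R , f F) Δ)) n ≡ seq (∣_∣ₘ ν δ) n
      right []      = refl
      right (a ∷ δ) = cong₂ (λ x y → seq x n ℚ.- 1ℚ ℚ.+ y) (f-value a) (right δ)
    total-atomic (a ∷ γ) δ n = trans
      (cong₂ (λ x y → 1ℚ ℚ.- seq x n ℚ.+ y) (f-value a) (total-atomic γ δ n))
      (solve 4 (λ o a d g → o :+ (:- a) :+ (d :+ (:- g)) := d :+ (:- (a :+ (:- o) :+ g))) refl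
        1ℚ (seq (∣_∣ₐ ν a) n) (seq (∣_∣ₘ ν δ) n) (seq (∣_∣ₘ ν γ) n))

  axiom : ∀ {w} → Valid w → AllMembers (¬_ ∘ IsImplication) w → Axiom w
  axiom {w} valid atomic M ν n = valid e λ t → n (true-atomic t atomic)
    where
    e : Model
    -- The margin 1 is an arbitrary positive number; the truth of a sequent does not depend on it.
    e = record { interpretation = M ; valuation = ν ; δ = 1ℚ ; 0<δ = ℚₚ.positive⁻¹ 1ℚ }

    isAtom : ∀ {s F} → QF (s , emb F) → ¬ IsImplication F → IsAtom F
    isAtom {F = rpl (atom P)} _ _  = atom P
    isAtom {F = rpl (A ⊃ B)}  _ ¬i = ⊥-elim (¬i (A , B , refl))
    isAtom {F = sp s}         _ _  = sp s

    atoms : ∀ {s Γ} → All QF (map (λ F → s , emb F) Γ) → All (¬_ ∘ IsImplication) Γ → All IsAtom Γ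
    atoms {Γ = []}        _        _        = []
    atoms {s} {Γ = F ∷ Γ} (q ∷ qs) (i ∷ is) = isAtom {s} q i ∷ atoms {s} qs is

    emb-value : ∀ {F} (a : IsAtom F) → memberValue (emb F) e ≡ HsInterpretation.∣_∣ₐ M ν a
    emb-value (atom P) = refl
    emb-value (sp s)   = refl

    true-atomic : ∀ {w} → Any (True e) w → AllMembers (¬_ ∘ IsImplication) w →
                  Any (HsInterpretation.TrueAtomic M ν) w
    true-atomic (there t) (_ ∷ as)  = there (true-atomic t as)
    true-atomic {(Γ ⇒ Δ) ∷ _} (here (qS , h)) ((iΓ , iΔ) ∷ _) = here (γ , ε , ≼-elim (≼-trans
        {0ᵣ} {total e (signed emb (Γ ⇒ Δ))} {HsInterpretation.∣_∣ₘ M ν ε -ᵣ HsInterpretation.∣_∣ₘ M ν γ}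
        h (≡⇒≼ (total-atomic M ν e emb emb-value γ ε))))
      where
      γ = atoms {L} (All.++⁻ˡ (map (λ F → L , emb F) Γ) qS) iΓ
      ε = atoms {R} (All.++⁻ʳ (map (λ F → L , emb F) Γ) qS) iΔ

  Propositional : Hypersequent → Set₁
  Propositional w = Σ[ D ∈ ⊢ w ] (Q D ≡ 0 × Mid D)

  weight-bound : ∀ {w w′ n} → w ≈ w′ → weight w ℕ.≤ n → weight w′ ℕ.≤ n
  weight-bound w≈ = ℕₚ.≤-trans (ℕₚ.≤-reflexive (sym (weight-resp w≈)))

  -- Both propositional rules preserve validity upwards and lower the weight. Once no implication is
  -- left, a true sequent, being quantifier-free, is atomic, so the hypersequent is an axiom even if
  -- quantifiers remain elsewhere.
  complete : ∀ n w → weight w ℕ.< n → Valid w → Propositional w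
  complete (suc n) w (s≤s w≤n) valid
    with Any.any? (λ (Γ ⇒ Δ) → Any.any? isImplication? Γ ⊎-dec Any.any? isImplication? Δ) w
  ... | no none = ax (axiom valid (¬anyMember⇒allMembers¬ none)) , refl , tt
  ... | yes some with find some
  ...   | (Γ ⇒ Δ) , S∈w , inj₁ i with find i
  ...     | _ , F∈Γ , A , B , refl with ∈⇒↭ F∈Γ
  ...       | Γ′ , p with focus {S′ = rpl (A ⊃ B) ∷ Γ′ ⇒ Δ} S∈w (p , refl) | freshSPVar L w
  ...         | 𝒢 , w≈ , _ | k , k∉ with complete n _
                  (ℕₚ.<-≤-trans (weight-⊃ˡ A B Γ′ Δ 𝒢 k) (weight-bound w≈ w≤n))
                  (valid-⊃ˡ k (valid-resp-≈ w≈ valid))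
  ...           | D , noQ , mid = →⇒ k w≈ k∉ D , noQ , noQ , mid
  complete (suc n) w (s≤s w≤n) valid | yes some | (Γ ⇒ Δ) , S∈w , inj₂ i with find i
  ...     | _ , F∈Δ , A , B , refl with ∈⇒↭ F∈Δ
  ...       | Δ′ , p with focus {S′ = Γ ⇒ rpl (A ⊃ B) ∷ Δ′} S∈w (refl , p)
  ...         | 𝒢 , w≈ , _ with complete n _
                  (ℕₚ.<-≤-trans (weight-⊃ʳ₁ A B Γ Δ′ 𝒢) (weight-bound w≈ w≤n))
                  (valid-⊃ʳ₁ (valid-resp-≈ w≈ valid))
                | complete n _
                  (ℕₚ.<-≤-trans (weight-⊃ʳ₂ A B Γ Δ′ 𝒢) (weight-bound w≈ w≤n))
                  (valid-⊃ʳ₂ (valid-resp-≈ w≈ valid))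
  ...           | D , noQ , mid | D′ , noQ′ , mid′ =
                  ⇒→ w≈ D D′ , cong₂ ℕ._+_ noQ noQ′ , (noQ , mid) , (noQ′ , mid′)

  open Updated

  -- Simulation of a proof in a hypersequent that covers its conclusion

  Typed : (SPVar → Value) → Set₁
  Typed ρ = ∀ s k → Allowed s (ρ (spvar s k))

  update-typed : ∀ {ρ v} s k → Typed ρ → Allowed s v → Typed (update _≟ₛ_ (spvar s k) v ρ)
  update-typed L k typed v-ok L j with does (k ℕₚ.≟ j)
  ... | true  = v-ok
  ... | false = typed L j
  update-typed L k typed v-ok R j = typed R j
  update-typed R k typed v-ok L j = typed L j
  update-typed R k typed v-ok R j with does (k ℕₚ.≟ j)
  ... | true  = v-ok
  ... | false = typed R j

  CoversAll : Hypersequent → (Model → Set) → ℕ → (Formula → Member) → Hypersequent → Set₁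
  CoversAll w K k f = All (λ S → Covers w K k (signed f S))

  coversAll-resp-≈ : ∀ {w K k f H H′} → H ≈ H′ → CoversAll w K k f H → CoversAll w K k f H′
  coversAll-resp-≈ {f = f} = ≈ₚ.All-resp-↭ λ {S} {T} (p , q) →
    covers-resp-↭ (↭-sym (signed-resp-≈ₛ f {S} {T} (p , q)))

  coversAll-map : ∀ {w w′ K K′ k k′ f g H} {P : Formula → Set} →
                  (∀ {X} → Covers w K k X → Covers w′ K′ k′ X) →
                  (∀ {F} → P F → f F ≡ g F) → AllMembers P H → CoversAll w K k f H → CoversAll w′ K′ k′ g H
  coversAll-map h agree []       []       = []
  coversAll-map {f = f} {g} h agree (p ∷ ps) (c ∷ cs) =
    subst (Covers _ _ _) (signed-cong agree p) (h c) ∷ coversAll-map h agree ps cs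

  covers-attach : ∀ {w K k f g s F m S} {P : Formula → Set} → (∀ {F} → P F → f F ≡ g F) → g F ≡ m →
                  All P (proj₁ S) × All P (proj₂ S) → Covers w K k ((s , m) ∷ signed f S) →
                  Covers w K k (signed g (attach s F S))
  covers-attach {f = f} {g} {s} {F} {S = S} agree refl p c = covers-resp-↭ (signed-attach g s F S)
    (subst (λ X → Covers _ _ _ ((s , g F) ∷ X)) (signed-cong agree p) c)

  covers-pair : ∀ {w K k f s F G m n} → f F ≡ m → f G ≡ n →
                Covers w K k ((s , m) ∷ (opposite s , n) ∷ []) → Covers w K k (signed f (pair s F G))
  covers-pair {f = f} {s} {F} {G} refl refl = covers-resp-↭ (signed-pair f s F G)

  detach : ∀ {P : Formula → Set} s {F S} → All P (proj₁ (attach s F S)) × All P (proj₂ (attach s F S)) →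
           P F × All P (proj₁ S) × All P (proj₂ S)
  detach L (pF ∷ pΓ , pΔ) = pF , pΓ , pΔ
  detach R (pΓ , pF ∷ pΔ) = pF , pΓ , pΔ

  inst-fresh-sp : ∀ {σ ρ p v F} → ¬ (sp p ≡ F) → inst σ ρ F ≡ inst σ (update _≟ₛ_ p v ρ) F
  inst-fresh-sp {F = rpl A} p∉ = refl
  inst-fresh-sp {ρ = ρ} {v = v} {F = sp q} p∉ = cong val (update-other _≟ₛ_ v ρ (p∉ ∘ cong sp))

  inst-fresh-par : ∀ {σ ρ a b F} → ¬ ParInMember a F → inst σ ρ F ≡ inst (update ℕₚ._≟_ a b σ) ρ F
  inst-fresh-par {σ} {a = a} {b} {F = rpl A} a∉ = cong rpl (rename-cong A λ c c∈ →
    update-other ℕₚ._≟_ {x = a} b σ λ { refl → a∉ (rpl c∈) })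
  inst-fresh-par {F = sp q} a∉ = refl

  rename-weak : ∀ σ s x A → rename σ (weak s x A) ≡ weak s x (rename σ A)
  rename-weak σ L x A = refl
  rename-weak σ R x A = refl

  rename-strong : ∀ σ s x A → rename σ (strong s x A) ≡ strong s x (rename σ A)
  rename-strong σ L x A = refl
  rename-strong σ R x A = refl

  par-strong : ∀ {a} s {x A} → ParInFormula a A → ParInFormula a (strong s x A)
  par-strong L p = ex _ p
  par-strong R p = all _ p

  record Simulated (w : Hypersequent) (K : Model → Set) (k : ℕ) (H : Hypersequent) : Set₁ where
    field
      {target} : Hypersequent
      σ        : Param → Param
      ρ        : SPVar → Value
      typed    : Typed ρ
      reaches  : Reaches 1 w target
      covered  : CoversAll target K k (inst σ ρ) H

  -- The variable of D is interpreted by the value of the variable that `w` introduced. Its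
  -- freshness in D keeps the remaining members unchanged under the new `ρ`.
  simulate-weak : ∀ {w K k σ ρ H 𝒢 S x A t} s j → Closed t → H ≈ attach s (rpl (weak s x A)) S ∷ 𝒢 →
                  spvar s j ∉ₛ H → Typed ρ → CoversAll w K k (inst σ ρ) H →
                  Simulated w K k (attach s (sp (spvar s j)) S ∷ pair s (rpl (weak s x A)) (sp (spvar s j)) ∷
                                   pair s (rpl (A [ t / x ])) (sp (spvar s j)) ∷ 𝒢)
  simulate-weak {w} {K} {k} {σ} {ρ} {S = S} {x} {A} {t} s j closed H≈ fr typed covers
    with coversAll-resp-≈ H≈ covers | allMembers-resp-≈ H≈ (¬anyMember⇒allMembers¬ fr)
  ... | c ∷ cs | p ∷ ps
    with weak-update s (rename-closed σ closed) c (subst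
           (λ B → signed (inst σ ρ) (attach s (rpl (weak s x A)) S) ↭ (s , rpl B) ∷ signed (inst σ ρ) S)
           (rename-weak σ s x A) (signed-attach (inst σ ρ) s (rpl (weak s x A)) S))
  ... | record { reaches = r ; good = v , refl , v-ok , c₂ , c₃ ; covered = c₁ } = record
    { σ       = σ
    ; ρ       = update _≟ₛ_ (spvar s j) v ρ
    ; typed   = update-typed {ρ} s j typed v-ok
    ; reaches = r
    ; covered =
        covers-attach inst-fresh-sp renamed (proj₂ (detach s p)) c₁ ∷
        covers-pair (cong rpl (rename-weak σ s x A)) renamed (c₂ k) ∷
        covers-pair (cong rpl (rename-subst σ t x A)) renamed (c₃ k) ∷
        coversAll-map (restrict (r .extends) id) inst-fresh-sp ps cs
    }
    where
    renamed : inst σ (update _≟ₛ_ (spvar s j) v ρ) (sp (spvar s j)) ≡ val v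
    renamed = cong val (update-same _≟ₛ_ (spvar s j) v ρ)

  -- The eigenparameter `a` of D is sent to `b`, possibly one that `w` used long ago. Freshness of
  -- `a` in D ensures that the other members do not notice the change of `σ`.
  simulate-strong : ∀ {w K k σ ρ H 𝒢 S x A} s a → H ≈ attach s (rpl (strong s x A)) S ∷ 𝒢 →
                    a ∉ₚ H → Typed ρ → CoversAll w K k (inst σ ρ) H →
                    Simulated w K k (attach s (rpl (A [ par a / x ])) S ∷ 𝒢)
  simulate-strong {w} {K} {k} {σ} {ρ} {S = S} {x} {A} s a H≈ fr typed covers
    with coversAll-resp-≈ H≈ covers | allMembers-resp-≈ H≈ (¬anyMember⇒allMembers¬ fr)
  ... | c ∷ cs | p ∷ ps
    with strong-update s c (subst
           (λ B → signed (inst σ ρ) (attach s (rpl (strong s x A)) S) ↭ (s , rpl B) ∷ signed (inst σ ρ) S)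
           (rename-strong σ s x A) (signed-attach (inst σ ρ) s (rpl (strong s x A)) S))
  ... | record { reaches = r ; good = b , refl ; covered = c₁ } = record
    { σ       = σ′
    ; ρ       = ρ
    ; typed   = typed
    ; reaches = r
    ; covered =
        covers-attach inst-fresh-par (cong rpl renamed) (proj₂ (detach s p)) c₁ ∷
        coversAll-map (restrict (r .extends) id) inst-fresh-par ps cs
    }
    where
    σ′ = update ℕₚ._≟_ a b σ
    renamed : rename σ′ (A [ par a / x ]) ≡ rename σ A [ par b / x ]
    renamed = trans (rename-subst σ′ (par a) x A) (cong₂ (λ c B → B [ par c / x ])
      (update-same ℕₚ._≟_ a b σ)
      (rename-cong A λ c c∈ → sym (update-other ℕₚ._≟_ {x = a} b σ
        λ { refl → proj₁ (detach s p) (rpl (par-strong s c∈)) })))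

  module _ {σ : Param → Param} {ρ : SPVar → Value} (typed : Typed ρ) (e : Model) where
    open Model e using (interpretation; D; point; ⟦par⟧; ⟦fun⟧; ⟦pred⟧; ⟦_⟧ₜ; ⟦_⟧ₜₛ; valuation)

    -- The assignments `σ` and `ρ` are absorbed into the interpretation, so that an axiom of D can
    -- be applied as it stands; `typed` provides the bounds that its variables require.
    reinterpretation : HsInterpretation
    reinterpretation = record
      { D = D ; point = point ; ⟦par⟧ = ⟦par⟧ ∘ σ ; ⟦fun⟧ = ⟦fun⟧ ; ⟦pred⟧ = ⟦pred⟧
      ; ⟦sp0⟧ = λ k → ρ (type0 k) e , typed R k e
      ; ⟦sp1⟧ = λ k → ρ (type1 k) e , typed L k e }

    private module I = HsInterpretation reinterpretation

    mutual
      rename-valueₜ : ∀ t → ⟦ valuation ⟧ₜ (renameₜ σ t) ≡ I.⟦_⟧ₜ valuation t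
      rename-valueₜ (var x)    = refl
      rename-valueₜ (par a)    = refl
      rename-valueₜ (app f ts) = cong (⟦fun⟧ f) (rename-valueₜₛ ts)

      rename-valueₜₛ : ∀ {n} (ts : Vec Term n) → ⟦ valuation ⟧ₜₛ (renameₜₛ σ ts) ≡ I.⟦_⟧ₜₛ valuation ts
      rename-valueₜₛ []       = refl
      rename-valueₜₛ (t ∷ ts) = cong₂ _∷_ (rename-valueₜ t) (rename-valueₜₛ ts)

    inst-value : ∀ {F} (a : IsAtom F) → memberValue (inst σ ρ F) e ≡ I.∣_∣ₐ valuation a
    inst-value (atom (pred P ts)) = cong (λ ds → proj₁ (⟦pred⟧ P ds)) (rename-valueₜₛ ts)
    inst-value (atom (const r))   = refl
    inst-value (sp (type0 k))     = refl
    inst-value (sp (type1 k))     = refl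

    atoms-quantifierFree : ∀ {s Γ} → All IsAtom Γ → All QF (map (λ F → s , inst σ ρ F) Γ)
    atoms-quantifierFree []            = []
    atoms-quantifierFree (atom P ∷ as) = atom (renameₐ σ P) ∷ atoms-quantifierFree as
    atoms-quantifierFree (sp s ∷ as)   = tt ∷ atoms-quantifierFree as

    -- Truth makes the total nonnegative while coverage makes it at most minus a positive margin.
    true⇒¬falsified : ∀ {w K k H} → K e → Falsified w e → CoversAll w K k (inst σ ρ) H →
                      ¬ Any (I.TrueAtomic valuation) H
    true⇒¬falsified e∈K falsified (_ ∷ cs) (there t) = true⇒¬falsified e∈K falsified cs t
    true⇒¬falsified {k = k} {H = (Γ ⇒ Δ) ∷ _} e∈K falsified (c ∷ _) (here (γ , ε , h)) =
      positive⋠0 (halves-pos k (0<δ e)) (margin≼0 (≼-intro h)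
        (covers-sound e∈K falsified c (All.++⁺ (atoms-quantifierFree γ) (atoms-quantifierFree ε))))
      where
      margin≼0 : 0ᵣ ≼ I.∣_∣ₘ valuation ε -ᵣ I.∣_∣ₘ valuation γ →
                 total e (signed (inst σ ρ) (Γ ⇒ Δ)) +ᵣ margin k e ≼ 0ᵣ → margin k e ≼ 0ᵣ
      margin≼0 h h′ = linear (h ⊕ h′) λ n → trans
        (cong (λ t → halves k (δ e) ℚ.+ (t ℚ.+ 0ℚ))
          (sym (total-atomic reinterpretation valuation e (inst σ ρ) inst-value γ ε n)))
        (solve 2 (λ t m → m :+ (t :+ con 0ℚ) := con 0ℚ :+ (t :+ m) :+ con 0ℚ) refl
          (seq (total e (signed (inst σ ρ) (Γ ⇒ Δ))) n) (halves k (δ e)))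

  -- Simulation of the propositional rules

  -- The new variable is given a value slightly below that of A ⊃ B, so that no sequent becomes true.
  lowered : RPL∀ → RPL∀ → ℕ → Value
  lowered A B k e = (truth A e ⊃ᵣ truth B e) -ᵣ fromℚ (halves (suc k) (δ e))

  module _ (A B : RPL∀) (k : ℕ) (e : Model) where
    private
      a b i : ℝ
      a = truth A e
      b = truth B e
      i = truth A e ⊃ᵣ truth B e
      m m′ : ℚ
      m  = halves k (δ e)
      m′ = halves (suc k) (δ e)

      implication-value : ∀ n → seq (total e ((R , rpl (A ⊃ B)) ∷ []) +ᵣ margin k e) n ≡
                          seq i n ℚ.- 1ℚ ℚ.+ 0ℚ ℚ.+ m
      implication-value n = refl

    -- The amount by which the variable was lowered is exactly the new margin; what remains is the
    -- bound of A ⊃ B by 1 - A + B.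
    lowered-residual :
      total e ((L , rpl B) ∷ (R , val (lowered A B k)) ∷ (R , rpl A) ∷ []) +ᵣ margin (suc k) e ≼ 0ᵣ
    lowered-residual = residual-lower (truth A e) (truth B e) m′ eq
      where
      eq : ∀ n →
        seq (total e ((L , rpl B) ∷ (R , val (lowered A B k)) ∷ (R , rpl A) ∷ []) +ᵣ margin (suc k) e) n ≡
        1ℚ ℚ.- seq b n ℚ.+ (seq i n ℚ.- m′ ℚ.- 1ℚ ℚ.+ (seq a n ℚ.- 1ℚ ℚ.+ 0ℚ)) ℚ.+ m′
      eq n = refl

    -- On the left the lowering raises the total by half of the old margin, and the new margin is
    -- the other half.
    lowered-left : total e ((L , val (lowered A B k)) ∷ []) +ᵣ margin (suc k) e ≼
                   total e ((L , rpl (A ⊃ B)) ∷ []) +ᵣ margin k e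
    lowered-left = left-lower (truth A e ⊃ᵣ truth B e) m m′ (half+half m) eq eq′
      where
      eq : ∀ n → seq (total e ((L , val (lowered A B k)) ∷ []) +ᵣ margin (suc k) e) n ≡
                 1ℚ ℚ.- (seq i n ℚ.- m′) ℚ.+ 0ℚ ℚ.+ m′
      eq n = refl
      eq′ : ∀ n → seq (total e ((L , rpl (A ⊃ B)) ∷ []) +ᵣ margin k e) n ≡ 1ℚ ℚ.- seq i n ℚ.+ 0ℚ ℚ.+ m
      eq′ n = refl

    top-right : 1ᵣ ≼ truth A e ⊃ᵣ truth B e →
                total e [] +ᵣ margin k e ≼ total e ((R , rpl (A ⊃ B)) ∷ []) +ᵣ margin k e
    top-right h = right-top (truth A e ⊃ᵣ truth B e) m
      {total e [] +ᵣ margin k e} {total e ((R , rpl (A ⊃ B)) ∷ []) +ᵣ margin k e} eq implication-value h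
      where
      eq : ∀ n → seq (total e [] +ᵣ margin k e) n ≡ 0ℚ ℚ.+ m
      eq n = refl

    below-right : 1ᵣ -ᵣ truth A e +ᵣ truth B e ≼ truth A e ⊃ᵣ truth B e →
                  total e ((L , rpl A) ∷ (R , rpl B) ∷ []) +ᵣ margin k e ≼
                  total e ((R , rpl (A ⊃ B)) ∷ []) +ᵣ margin k e
    below-right h = right-below (truth A e) (truth B e) (truth A e ⊃ᵣ truth B e) m
      {total e ((L , rpl A) ∷ (R , rpl B) ∷ []) +ᵣ margin k e}
      {total e ((R , rpl (A ⊃ B)) ∷ []) +ᵣ margin k e}
      eq implication-value h
      where
      eq : ∀ n → seq (total e ((L , rpl A) ∷ (R , rpl B) ∷ []) +ᵣ margin k e) n ≡
                 1ℚ ℚ.- seq a n ℚ.+ (seq b n ℚ.- 1ℚ ℚ.+ 0ℚ) ℚ.+ m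
      eq n = refl

  -- In every model A ⊃ B has one of the two values, so K is the union of these two classes.
  IsTop IsBelow : (Model → Set) → RPL∀ → RPL∀ → Model → Set
  IsTop   K A B e = K e × 1ᵣ ≼ truth A e ⊃ᵣ truth B e
  IsBelow K A B e = K e × 1ᵣ -ᵣ truth A e +ᵣ truth B e ≼ truth A e ⊃ᵣ truth B e

  module _ {w : Hypersequent} {K : Model → Set} {k : ℕ} (A B : RPL∀) where
    restrict-top : ∀ {X} → Covers w K k X → Covers w (IsTop K A B) k X
    restrict-top = restrict extends-refl sub
      where
      sub : ∀ {e} → IsTop K A B e → K e
      sub = proj₁

    restrict-below : ∀ {X} → Covers w K k X → Covers w (IsBelow K A B) k X
    restrict-below = restrict extends-refl sub
      where
      sub : ∀ {e} → IsBelow K A B e → K e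
      sub = proj₁

  module _ {w : Hypersequent} {K : Model → Set} {k : ℕ} (A B : RPL∀)
           (qA : QuantifierFree A) (qB : QuantifierFree B) where
    covers-lowered : ∀ {Y} → Covers w K k ((L , rpl (A ⊃ B)) ∷ Y) →
                     Covers w K (suc k) ((L , val (lowered A B k)) ∷ Y)
    covers-lowered = replace ((L , rpl (A ⊃ B)) ∷ []) ((L , val (lowered A B k)) ∷ []) refl
      ((qA ⊃ qB) ∷ []) (tt ∷ []) (λ e _ → lowered-left A B k e)

    covers-residual : Covers w K (suc k) ((L , rpl B) ∷ (R , val (lowered A B k)) ∷ (R , rpl A) ∷ [])
    covers-residual = false (qB ∷ tt ∷ qA ∷ []) λ e _ → lowered-residual A B k e

    -- With A ⊃ B equal to 1 its contribution on the right is 0, so it may be erased.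
    covers-top : ∀ {Y} → Covers w K k ((R , rpl (A ⊃ B)) ∷ Y) → Covers w (IsTop K A B) k Y
    covers-top c = replace ((R , rpl (A ⊃ B)) ∷ []) [] refl ((qA ⊃ qB) ∷ []) []
      (λ e (_ , top) → top-right A B k e top) (restrict-top A B c)

    -- In this class A on the left and B on the right together contribute no more than A ⊃ B on the
    -- right.
    covers-below : ∀ {Y} → Covers w K k ((R , rpl (A ⊃ B)) ∷ Y) →
                   Covers w (IsBelow K A B) k ((L , rpl A) ∷ (R , rpl B) ∷ Y)
    covers-below c = replace ((R , rpl (A ⊃ B)) ∷ []) ((L , rpl A) ∷ (R , rpl B) ∷ []) refl
      ((qA ⊃ qB) ∷ []) (qA ∷ qB ∷ []) (λ e (_ , below) → below-right A B k e below) (restrict-below A B c)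

  module _ {w H 𝒢 : Hypersequent} {K : Model → Set} {k : ℕ} {σ : Param → Param} {ρ : SPVar → Value}
           {Γ Δ : List Formula} {A B : RPL∀} (qA : QuantifierFree A) (qB : QuantifierFree B)
           (covers : CoversAll w K k (inst σ ρ) H) where
    private
      qA′ = rename-quantifierFree σ qA
      qB′ = rename-quantifierFree σ qB

    simulate-⊃ˡ : ∀ j → H ≈ (rpl (A ⊃ B) ∷ Γ ⇒ Δ) ∷ 𝒢 → type1 j ∉ₛ H →
                  CoversAll w K (suc k)
                    (inst σ (update _≟ₛ_ (type1 j) (lowered (rename σ A) (rename σ B) k) ρ))
                    ((sp (type1 j) ∷ Γ ⇒ Δ) ∷ (rpl B ∷ [] ⇒ sp (type1 j) ∷ rpl A ∷ []) ∷ 𝒢)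
    simulate-⊃ˡ j H≈ fr = simulate-with (lowered (rename σ A) (rename σ B) k)
      (covers-lowered (rename σ A) (rename σ B) qA′ qB′) (covers-residual (rename σ A) (rename σ B) qA′ qB′)
      (coversAll-resp-≈ H≈ covers) (allMembers-resp-≈ H≈ (¬anyMember⇒allMembers¬ fr))
      where
      simulate-with : ∀ v →
        (∀ {Y} → Covers w K k ((L , rpl (rename σ A ⊃ rename σ B)) ∷ Y) →
                 Covers w K (suc k) ((L , val v) ∷ Y)) →
        Covers w K (suc k) ((L , rpl (rename σ B)) ∷ (R , val v) ∷ (R , rpl (rename σ A)) ∷ []) →
        CoversAll w K k (inst σ ρ) ((rpl (A ⊃ B) ∷ Γ ⇒ Δ) ∷ 𝒢) →
        AllMembers (λ F → ¬ (sp (type1 j) ≡ F)) ((rpl (A ⊃ B) ∷ Γ ⇒ Δ) ∷ 𝒢) →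
        CoversAll w K (suc k) (inst σ (update _≟ₛ_ (type1 j) v ρ))
          ((sp (type1 j) ∷ Γ ⇒ Δ) ∷ (rpl B ∷ [] ⇒ sp (type1 j) ∷ rpl A ∷ []) ∷ 𝒢)
      simulate-with v lower residual (c ∷ cs) (p ∷ ps) =
        covers-attach {f = inst σ ρ} {s = L} {F = sp (type1 j)} {S = Γ ⇒ Δ}
          inst-fresh-sp renamed (proj₂ (detach L p)) (lower c) ∷
        subst (λ m → Covers w K (suc k) ((L , rpl (rename σ B)) ∷ (R , m) ∷ (R , rpl (rename σ A)) ∷ []))
          (sym renamed) residual ∷
        coversAll-map covers-suc inst-fresh-sp ps cs
        where
        renamed : inst σ (update _≟ₛ_ (type1 j) v ρ) (sp (type1 j)) ≡ val v
        renamed = cong val (update-same _≟ₛ_ (type1 j) v ρ)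

    module _ (H≈ : H ≈ (Γ ⇒ rpl (A ⊃ B) ∷ Δ) ∷ 𝒢) where
      simulate-⊃ʳ₁ : CoversAll w (IsTop K (rename σ A) (rename σ B)) k (inst σ ρ) ((Γ ⇒ Δ) ∷ 𝒢)
      simulate-⊃ʳ₁ = simulate-with (coversAll-resp-≈ H≈ covers)
        where
        simulate-with : CoversAll w K k (inst σ ρ) ((Γ ⇒ rpl (A ⊃ B) ∷ Δ) ∷ 𝒢) →
                        CoversAll w (IsTop K (rename σ A) (rename σ B)) k (inst σ ρ) ((Γ ⇒ Δ) ∷ 𝒢)
        simulate-with (c ∷ cs) = covers-top (rename σ A) (rename σ B) qA′ qB′
            (covers-resp-↭ (↭-sym (signed-attach (inst σ ρ) R (rpl (A ⊃ B)) (Γ ⇒ Δ))) c)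
          ∷ All.map (restrict-top (rename σ A) (rename σ B)) cs

      simulate-⊃ʳ₂ : CoversAll w (IsBelow K (rename σ A) (rename σ B)) k (inst σ ρ)
                       ((rpl A ∷ Γ ⇒ rpl B ∷ Δ) ∷ 𝒢)
      simulate-⊃ʳ₂ = simulate-with (coversAll-resp-≈ H≈ covers)
        where
        simulate-with : CoversAll w K k (inst σ ρ) ((Γ ⇒ rpl (A ⊃ B) ∷ Δ) ∷ 𝒢) →
                        CoversAll w (IsBelow K (rename σ A) (rename σ B)) k (inst σ ρ)
                          ((rpl A ∷ Γ ⇒ rpl B ∷ Δ) ∷ 𝒢)
        simulate-with (c ∷ cs) = covers-resp-↭ (prep _ (signed-attach (inst σ ρ) R (rpl B) (Γ ⇒ Δ)))
            (covers-below (rename σ A) (rename σ B) qA′ qB′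
              (covers-resp-↭ (↭-sym (signed-attach (inst σ ρ) R (rpl (A ⊃ B)) (Γ ⇒ Δ))) c))
          ∷ All.map (restrict-below (rename σ A) (rename σ B)) cs

  -- Induction on the given proof

  prenex-all : ∀ {x A} → Prenex (all x A) → Prenex A
  prenex-all (all x p) = p

  prenex-ex : ∀ {x A} → Prenex (ex x A) → Prenex A
  prenex-ex (ex x p) = p

  Outcome : ℕ → Hypersequent → (Model → Set) → Set₁
  Outcome n w K = ∃[ w′ ] (Reaches n w w′ × Refutes K w′)

  after : ∀ {m n w w′ K} → Reaches m w w′ → Outcome n w′ K → Outcome (m ℕ.+ n) w K
  after r (w″ , r′ , refutes) = w″ , reaches-trans r r′ , refutes

  -- The second replay is a function of the extension because its starting point is whatever the
  -- first one reaches. A model falsifying the final hypersequent falsifies the intermediate one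
  -- too, so whichever class it lies in, it is refuted.
  merge : ∀ {m n w K} A B → Outcome m w (IsTop K A B) →
          (∀ {w′} → Extends w w′ → Outcome n w′ (IsBelow K A B)) → Outcome (m ℕ.+ n) w K
  merge {w = w} {K} A B (w₁ , r₁ , refutes₁) continue = finish (continue (r₁ .extends))
    where
    finish : ∀ {n} → Outcome n w₁ (IsBelow K A B) → Outcome (_ ℕ.+ n) w K
    finish (w₂ , r₂ , refutes₂) = w₂ , reaches-trans r₁ r₂ , λ e e∈K falsified →
      ⊃ᵣ-cases (truth A e) (truth B e) λ where
        (inj₁ top)   → refutes₁ e (e∈K , top) (falsified-extends (r₂ .extends) falsified)
        (inj₂ below) → refutes₂ e (e∈K , below) falsified

  simulate : ∀ {H} (D : ⊢ H) → AllMembers PrenexOrSP H → ∀ {w K k σ ρ} → Typed ρ →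
             CoversAll w K k (inst σ ρ) H → Outcome (Q D) w K
  simulate (ax axiom) _ {w} {σ = σ} {ρ} typed covers = w , reaches-refl , λ e e∈K falsified →
    axiom (reinterpretation {σ} {ρ} typed e) (Model.valuation e)
      (true⇒¬falsified {σ} {ρ} typed e e∈K falsified covers)
  simulate (→⇒ {A = A} {B} j H≈ fr D) prenex {k = k} {σ} {ρ} typed covers
    with allMembers-resp-≈ H≈ prenex
  ... | (rpl p ∷ pΓ , pΔ) ∷ p𝒢 with prenex-⊃ p
  ...   | qA , qB = simulate D
    ((sp (type1 j) ∷ pΓ , pΔ) ∷ (rpl (qf qB) ∷ [] , sp (type1 j) ∷ rpl (qf qA) ∷ []) ∷ p𝒢)
    (update-typed {ρ} L j typed λ e → ⊃ᵣ-lower≤1 (truth (rename σ A) e) (truth (rename σ B) e)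
      (ℚₚ.<⇒≤ (halves-pos (suc k) (0<δ e))))
    (simulate-⊃ˡ qA qB covers j H≈ fr)
  simulate (⇒→ {A = A} {B} H≈ D E) prenex {σ = σ} typed covers
    with allMembers-resp-≈ H≈ prenex
  ... | (pΓ , rpl p ∷ pΔ) ∷ p𝒢 with prenex-⊃ p
  ...   | qA , qB = merge (rename σ A) (rename σ B)
    (simulate D ((pΓ , pΔ) ∷ p𝒢) typed (simulate-⊃ʳ₁ qA qB covers H≈))
    -- The coverage of the conclusion, from before the first replay, is carried over to the
    -- hypersequent now reached; quantifier rules already applied there are not repeated.
    (λ ext → simulate E ((rpl (qf qA) ∷ pΓ , rpl (qf qB) ∷ pΔ) ∷ p𝒢) typed
      (simulate-⊃ʳ₂ qA qB (All.map (restrict ext id) covers) H≈))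
  simulate (∀⇒ j {t} closed H≈ fr D) prenex typed covers
    with allMembers-resp-≈ H≈ prenex | simulate-weak L j closed H≈ fr typed covers
  ... | (rpl p ∷ pΓ , pΔ) ∷ p𝒢 | s = after (reaches s) (simulate D
      ((sp _ ∷ pΓ , pΔ) ∷ (rpl p ∷ [] , sp _ ∷ []) ∷
       (rpl (subst-prenex t _ (prenex-all p)) ∷ [] , sp _ ∷ []) ∷ p𝒢) (Simulated.typed s) (covered s))
    where open Simulated using (reaches; covered)
  simulate (⇒∃ j {t} closed H≈ fr D) prenex typed covers
    with allMembers-resp-≈ H≈ prenex | simulate-weak R j closed H≈ fr typed covers
  ... | (pΓ , rpl p ∷ pΔ) ∷ p𝒢 | s = after (reaches s) (simulate D
      ((pΓ , sp _ ∷ pΔ) ∷ (sp _ ∷ [] , rpl p ∷ []) ∷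
       (sp _ ∷ [] , rpl (subst-prenex t _ (prenex-ex p)) ∷ []) ∷ p𝒢) (Simulated.typed s) (covered s))
    where open Simulated using (reaches; covered)
  simulate (⇒∀ a H≈ fr D) prenex typed covers
    with allMembers-resp-≈ H≈ prenex | simulate-strong R a H≈ fr typed covers
  ... | (pΓ , rpl p ∷ pΔ) ∷ p𝒢 | s = after (reaches s) (simulate D
      ((pΓ , rpl (subst-prenex (par a) _ (prenex-all p)) ∷ pΔ) ∷ p𝒢) (Simulated.typed s) (covered s))
    where open Simulated using (reaches; covered)
  simulate (∃⇒ a H≈ fr D) prenex typed covers
    with allMembers-resp-≈ H≈ prenex | simulate-strong L a H≈ fr typed covers
  ... | (rpl p ∷ pΓ , pΔ) ∷ p𝒢 | s = after (reaches s) (simulate D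
      ((rpl (subst-prenex (par a) _ (prenex-ex p)) ∷ pΓ , pΔ) ∷ p𝒢) (Simulated.typed s) (covered s))
    where open Simulated using (reaches; covered)

  inst-id : ∀ F → inst id spValue F ≡ emb F
  inst-id (rpl A) = cong rpl (rename-id A)
  inst-id (sp s)  = refl

  midProof : ∀ {w} → Refutes (λ _ → ⊤) w → MidProof w 0
  midProof {w} refutes with complete _ w ℕₚ.≤-refl (refutes⇒valid refutes)
  ... | D , noQ , mid = D , mid , ℕₚ.≤-reflexive noQ

  -- The replay starts with every sequent covering itself, parameters unchanged, variables at their
  -- own values and the full margin.
  mid-hypersequent : ∀ {H} → AllMembers PrenexOrSP H → (D : ⊢ H) → MidProof H (Q D)
  mid-hypersequent {H} prenex D
    with simulate D prenex {w = H} {K = λ _ → ⊤} {k = 0} {σ = id} {ρ = spValue} spValue-allowed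
           (All.tabulate λ {S} S∈H → subst (Covers H _ 0) (sym (signed-cong′ inst-id S)) (member S∈H refl))
  ... | w , r , refutes = subst (MidProof H) (ℕₚ.+-identityʳ (Q D)) (r .lower (midProof refutes))

theorem4 : (Sig : Signature) → let open Calculus Sig in
    (H : Hypersequent) → AllMembers PrenexOrSP H →
    (D : ⊢ H) → Σ[ D̂ ∈ ⊢ H ] (Mid D̂ × Q D̂ ≤ Q D)
theorem4 Sig H = Proof.mid-hypersequent Sig
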